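{- Let $S$ be a recurrent specular set on the finite alphabet $A$ relative to the involution $\theta$, and let $X\subset S$ be a finite symmetric bifix code. Let $d\ge 1$ be an integer. Then $X$ is an $S$-maximal bifix code of $S$-degree $d$ if and only if $X$ is a monoidal basis of a subgroup of index $d$ of $G_\theta$.
   Context: Words are over a finite alphabet $A$; $\varepsilon$ is the empty word. A set $S$ of words on $A$ is factorial if it contains $A$ and all the factors of its elements. For $w\in S$ let $L(w)=\{a\in A\mid aw\in S\}$, $R(w)=\{a\in A\mid wa\in S\}$, $B(w)=\{(a,b)\in A\times A\mid awb\in S\}$. A factorial set $S$ is biextendable if $B(w)\neq\emptyset$ for all $w\in S$. The extension graph $\mathcal{E}(w)$ is the undirected graph whose vertex set is the disjoint union of $L(w)$ and $R(w)$ and whose edges are the pairs in $B(w)$. A biextendable set $S$ is a tree set of characteristic $c$ if $\mathcal{E}(w)$ is a tree for every nonempty $w\in S$ and $\mathcal{E}(\varepsilon)$ is a disjoint union of $c$ trees. Let $\theta$ be an involution on $A$ (possibly with fixed points) and let $G_\theta$ be the group generated by $A$ with relations $a\theta(a)=1$, $a\in A$ (so $a^{ -1}=\theta(a)$). A word is reduced if it has no factor $a\theta(a)$ with $a\in A$; every element of $G_\theta$ is represented by a unique reduced word, and reduced words are identified with elements of $G_\theta$. A laminary set on $A$ relative to $\theta$ is a biextendable set of reduced words closed under taking inverses. A specular set is a laminary set which is a tree set of characteristic $2$. A set $S\ne\{\varepsilon\}$ is recurrent if it is factorial and for all $u,w\in S$ there is $v\in S$ with $uvw\in S$. A bifix code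 is a set of nonempty words in which no element is a proper prefix or a proper suffix of another. A bifix code $X\subset S$ is $S$-maximal if it is not properly contained in a bifix code $Y\subset S$. A parse of a word $w$ with respect to $X$ is a triple $(q,x,p)$ with $w=qxp$, where $q$ has no suffix in $X$, $x\in X^*$ and $p$ has no prefix in $X$. The $S$-degree of $X$ is the maximal number of parses with respect to $X$ of a word of $S$. A subset $X$ of a group is symmetric if it is closed under taking inverses. A set $X$ is a monoidal basis of a group $H$ if $X\subset H$ is symmetric, the monoid generated by $X$ is $H$, and any product $x_1x_2\cdots x_m$ ($m\ge1$) of elements of $X$ such that $x_kx_{k+1}\neq 1$ for $1\le k\le m-1$ is different from $1$. -}

module Defs where

open import Level using (0ℓ)
open import Algebra.Bundles using (Group)
import Algebra.Properties.Group as GroupProperties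
open import Data.Empty using (⊥)
open import Data.Fin.Base using (Fin)
open import Data.List.Base using (List; []; _∷_; [_]; _++_; concat; foldr; length)
open import Data.List.Membership.Propositional using () renaming (_∈_ to _∈ₗ_)
open import Data.List.Relation.Binary.Infix.Heterogeneous using (Infix; fromView; MkView)
open import Data.List.Relation.Binary.Prefix.Heterogeneous using (Prefix)
open import Data.List.Relation.Binary.Suffix.Heterogeneous using (Suffix)
import Data.List.Relation.Binary.Pointwise as Pointwise
open import Data.List.Properties using (++-identityʳ)
open import Data.List.Relation.Unary.All using (All)
open import Data.List.Relation.Unary.Linked using (Linked)
open import Data.List.Relation.Unary.Unique.Propositional using (Unique)
open import Data.Nat.Base using (ℕ; _≤_)
open import Data.Product.Base using (_×_; _,_; proj₁; proj₂; ∃-syntax; ∃₂)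
open import Data.Sum.Base using (_⊎_; inj₁; inj₂)
open import Function.Bundles using (Inverse; _⇔_)
open import Relation.Binary.Bundles using (Setoid)
open import Relation.Binary.Construct.Closure.ReflexiveTransitive using (Star)
open import Relation.Binary.Core using (Rel)
open import Relation.Binary.PropositionalEquality using (_≡_; _≢_; refl; subst)
import Relation.Binary.PropositionalEquality as ≡
open import Relation.Nullary.Negation using (¬_)
open import Relation.Unary using (Pred; _∈_; _∉_; _⊆_; _⊂_; _≐_; Satisfiable; ｛_｝)

Word : Set → Set
Word A = List A

Language : Set → Set₁
Language A = Pred (Word A) 0ℓ

infix 4 _isPrefixOf_ _isSuffixOf_ _isFactorOf_

_isPrefixOf_ _isSuffixOf_ _isFactorOf_ : {A : Set} → Rel (Word A) 0ℓ
_isPrefixOf_ = Prefix _≡_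
_isSuffixOf_ = Suffix _≡_
_isFactorOf_ = Infix _≡_

_⋆ : {A : Set} → Language A → Language A
(X ⋆) w = ∃[ xs ] All X xs × concat xs ≡ w

IsFinite : {A : Set} → Language A → Set
IsFinite X = ∃[ xs ] (∀ w → w ∈ X ⇔ w ∈ₗ xs)

record Factorial {A : Set} (S : Language A) : Set where
  field
    letters : ∀ a → [ a ] ∈ S
    factors : ∀ {u w} → u isFactorOf w → w ∈ S → u ∈ S

module _ {A : Set} (S : Language A) where

  L R : Word A → Pred A 0ℓ
  L w a = a ∷ w ∈ S
  R w a = w ++ [ a ] ∈ S

  B : Word A → Pred (A × A) 0ℓ
  B w (a , b) = a ∷ w ++ [ b ] ∈ S

  record Biextendable : Set where
    field
      factorial  : Factorial S
      extendable : ∀ w → w ∈ S → Satisfiable (B w)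

  record Recurrent : Set where
    field
      nontrivial : ¬ (S ≐ ｛ [] ｝)
      factorial  : Factorial S
      recur      : ∀ u w → u ∈ S → w ∈ S → ∃[ v ] v ∈ S × u ++ v ++ w ∈ S

-- The vertices are a subset of V, so that L(w) and R(w) need not be
-- turned into types.
record Graph (V : Set) : Set₁ where
  field
    Vertex      : Pred V 0ℓ
    Edge        : Rel V 0ℓ
    edge-sym    : ∀ {u v} → Edge u v → Edge v u
    edge-irrefl : ∀ {v} → ¬ Edge v v
    edge-vertex : ∀ {u v} → Edge u v → Vertex u

module _ {V : Set} (G : Graph V) where
  open Graph G

  -- The list v ∷ vs enumerates the vertices of the cycle once each;
  -- appending v closes it up.
  Cycle : Set
  Cycle = ∃₂ λ v vs → Unique (v ∷ vs) × 3 ≤ length (v ∷ vs) × Linked Edge (v ∷ vs ++ [ v ])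

  -- The empty graph must not count as a tree: otherwise the empty set
  -- on the empty alphabet would be a tree set.
  record IsTree : Set where
    field
      nonempty  : Satisfiable Vertex
      connected : ∀ u v → Vertex u → Vertex v → Star Edge u v
      acyclic   : ¬ Cycle

module _ {V : Set} (G : Graph V) where
  open Graph G

  record IsDisjointUnionOfTrees (c : ℕ) : Set₁ where
    field
      component : Fin c → Graph V
      tree      : ∀ i → IsTree (component i)
      disjoint  : ∀ i j v → Graph.Vertex (component i) v → Graph.Vertex (component j) v → i ≡ j
      vertices  : ∀ v → Vertex v ⇔ (∃[ i ] Graph.Vertex (component i) v)
      edges     : ∀ u v → Edge u v ⇔ (∃[ i ] Graph.Edge (component i) u v)

-- In the extension graph of w, left extensions are tagged inj₁ and
-- right extensions inj₂.  Factoriality ensures that both ends of an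
-- edge are vertices.
module _ {A : Set} {S : Language A} (F : Factorial S) where

  private
    aw-factor : ∀ (a : A) w b → (a ∷ w) isFactorOf (a ∷ w ++ [ b ])
    aw-factor a w b = fromView (MkView [] (Pointwise.refl refl) [ b ])

    wb-factor : ∀ (a : A) w b → (w ++ [ b ]) isFactorOf (a ∷ w ++ [ b ])
    wb-factor a w b =
      subst (λ z → (w ++ [ b ]) isFactorOf (a ∷ z)) (++-identityʳ (w ++ [ b ]))
        (fromView (MkView [ a ] (Pointwise.refl refl) []))

  ℰ : Word A → Graph (A ⊎ A)
  ℰ w = record
    { Vertex      = V
    ; Edge        = E
    ; edge-sym    = λ {u} {v} → sym {u} {v}
    ; edge-irrefl = λ {v} → irrefl {v}
    ; edge-vertex = λ {u} {v} → vertex {u} {v}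
    }
    where
    V : Pred (A ⊎ A) 0ℓ
    V (inj₁ a) = a ∈ L S w
    V (inj₂ b) = b ∈ R S w

    E : Rel (A ⊎ A) 0ℓ
    E (inj₁ a) (inj₂ b) = (a , b) ∈ B S w
    E (inj₂ b) (inj₁ a) = (a , b) ∈ B S w
    E (inj₁ _) (inj₁ _) = ⊥
    E (inj₂ _) (inj₂ _) = ⊥

    sym : ∀ {u v} → E u v → E v u
    sym {inj₁ _} {inj₂ _} e = e
    sym {inj₂ _} {inj₁ _} e = e

    irrefl : ∀ {v} → ¬ E v v
    irrefl {inj₁ _} ()
    irrefl {inj₂ _} ()

    vertex : ∀ {u v} → E u v → V u
    vertex {inj₁ a} {inj₂ b} e = Factorial.factors F (aw-factor a w b) e
    vertex {inj₂ b} {inj₁ a} e = Factorial.factors F (wb-factor a w b) e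

record IsTreeSet {A : Set} (S : Language A) (c : ℕ) : Set₁ where
  field
    biextendable : Biextendable S
  open Biextendable biextendable public
  field
    tree   : ∀ w → w ∈ S → w ≢ [] → IsTree (ℰ factorial w)
    forest : IsDisjointUnionOfTrees (ℰ factorial []) c

record BifixCode {A : Set} (X : Language A) : Set where
  field
    nonempty    : [] ∉ X
    prefix-free : ∀ {u v} → u ∈ X → v ∈ X → u isPrefixOf v → u ≡ v
    suffix-free : ∀ {u v} → u ∈ X → v ∈ X → u isSuffixOf v → u ≡ v

module _ {A : Set} (S : Language A) where

  record IsMaximalBifixCode (X : Language A) : Set₁ where
    field
      bifix   : BifixCode X
      subset  : X ⊆ S
      maximal : ∀ (Y : Language A) → BifixCode Y → Y ⊆ S → ¬ (X ⊂ Y)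

module _ {A : Set} (X : Language A) where

  record IsParse (w : Word A) (t : Word A × Word A × Word A) : Set where
    q = proj₁ t
    x = proj₁ (proj₂ t)
    p = proj₂ (proj₂ t)
    field
      factorization : w ≡ q ++ x ++ p
      q-no-suffix   : ∀ {u} → u isSuffixOf q → u ∉ X
      x∈X⋆          : x ∈ X ⋆
      p-no-prefix   : ∀ {u} → u isPrefixOf p → u ∉ X

  -- Parses are counted as triples of words, not as inhabitants of
  -- IsParse, whose proof components need not be unique.
  HasParseCount : Word A → ℕ → Set
  HasParseCount w n = ∃[ ts ] Unique ts × (∀ t → IsParse w t ⇔ t ∈ₗ ts) × length ts ≡ n

record HasDegree {A : Set} (S X : Language A) (d : ℕ) : Set where
  field
    attained : ∃[ w ] w ∈ S × HasParseCount X w d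
    bound    : ∀ w n → w ∈ S → HasParseCount X w n → n ≤ d

module _ (G : Group 0ℓ 0ℓ) where
  open Group G renaming (refl to ≈-refl; sym to ≈-sym; trans to ≈-trans)

  IsSymmetric : Pred Carrier 0ℓ → Set
  IsSymmetric P = ∀ {g} → g ∈ P → g ⁻¹ ∈ P

  record Subgroup : Set₁ where
    field
      Member    : Pred Carrier 0ℓ
      resp      : ∀ {g h} → g ≈ h → g ∈ Member → h ∈ Member
      ε-closed  : ε ∈ Member
      ∙-closed  : ∀ {g h} → g ∈ Member → h ∈ Member → g ∙ h ∈ Member
      ⁻¹-closed : ∀ {g} → g ∈ Member → g ⁻¹ ∈ Member

  -- Right cosets: g and h are identified when Hg = Hh.
  Cosets : Subgroup → Setoid 0ℓ 0ℓ
  Cosets H = record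
    { Carrier       = Carrier
    ; _≈_           = λ g h → g ∙ h ⁻¹ ∈ Member
    ; isEquivalence = record
      { refl  = λ {g} → resp (≈-sym (inverseʳ g)) ε-closed
      ; sym   = λ {g} {h} m → resp (⁻¹-anti-homo-// g h) (⁻¹-closed m)
      ; trans = λ {g} {h} {k} m n → resp (cancel g h k) (∙-closed m n)
      }
    }
    where
    open Subgroup H
    open GroupProperties G using (⁻¹-anti-homo-//; \\-leftDividesʳ)

    cancel : ∀ g h k → (g ∙ h ⁻¹) ∙ (h ∙ k ⁻¹) ≈ g ∙ k ⁻¹
    cancel g h k = ≈-trans (assoc g (h ⁻¹) (h ∙ k ⁻¹)) (∙-congˡ (\\-leftDividesʳ h (k ⁻¹)))

  HasIndex : Subgroup → ℕ → Set
  HasIndex H d = Inverse (Cosets H) (≡.setoid (Fin d))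

  product : List Carrier → Carrier
  product = foldr _∙_ ε

  GeneratedMonoid : Pred Carrier 0ℓ → Pred Carrier 0ℓ
  GeneratedMonoid P g = ∃[ gs ] All P gs × product gs ≈ g

  record IsMonoidalBasis (P : Pred Carrier 0ℓ) (H : Subgroup) : Set where
    open Subgroup H using (Member)
    field
      subset    : P ⊆ Member
      symmetric : IsSymmetric P
      generates : GeneratedMonoid P ≐ Member
      free      : ∀ g gs → All P (g ∷ gs) → Linked (λ x y → ¬ (x ∙ y ≈ ε)) (g ∷ gs) →
                  ¬ (product (g ∷ gs) ≈ ε)

data Expr (A : Set) : Set where
  gen  : A → Expr A
  one  : Expr A
  _·_  : Expr A → Expr A → Expr A
  _⁻   : Expr A → Expr A

infixl 7 _·_
infix  8 _⁻

⟦_⟧ : {A : Set} → Word A → Expr A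
⟦_⟧ = foldr (λ a g → gen a · g) one

module _ {A : Set} (θ : A → A) where

  infix 4 _~_

  -- The group presented by A and the relations a θ(a) = 1 is taken
  -- literally: group terms modulo the least congruence containing the
  -- group axioms and the relations.
  data _~_ : Rel (Expr A) 0ℓ where
    relation  : ∀ a → gen a · gen (θ a) ~ one
    ~-refl    : ∀ {g} → g ~ g
    ~-sym     : ∀ {g h} → g ~ h → h ~ g
    ~-trans   : ∀ {g h k} → g ~ h → h ~ k → g ~ k
    ·-cong    : ∀ {g g′ h h′} → g ~ g′ → h ~ h′ → g · h ~ g′ · h′
    ⁻-cong    : ∀ {g h} → g ~ h → g ⁻ ~ h ⁻
    ·-assoc   : ∀ g h k → (g · h) · k ~ g · (h · k)
    identityˡ : ∀ g → one · g ~ g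
    identityʳ : ∀ g → g · one ~ g
    inverseˡ  : ∀ g → g ⁻ · g ~ one
    inverseʳ  : ∀ g → g · g ⁻ ~ one

  Gθ : Group 0ℓ 0ℓ
  Gθ = record
    { Carrier = Expr A
    ; _≈_     = _~_
    ; _∙_     = _·_
    ; ε       = one
    ; _⁻¹     = _⁻
    ; isGroup = record
      { isMonoid = record
        { isSemigroup = record
          { isMagma = record
            { isEquivalence = record { refl = ~-refl ; sym = ~-sym ; trans = ~-trans }
            ; ∙-cong        = ·-cong
            }
          ; assoc = ·-assoc
          }
        ; identity = identityˡ , identityʳ
        }
      ; inverse = inverseˡ , inverseʳ
      ; ⁻¹-cong = ⁻-cong
      }
    }

  -- A set of words viewed as a subset of the group; on sets of reduced
  -- words this is the identification of reduced words with group
  -- elements.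
  ⟪_⟫ : Language A → Pred (Expr A) 0ℓ
  ⟪ X ⟫ g = ∃[ w ] w ∈ X × ⟦ w ⟧ ~ g

  Reduced : Language A
  Reduced w = ∀ a → ¬ ((a ∷ θ a ∷ []) isFactorOf w)

  record IsLaminary (S : Language A) : Set where
    field
      biextendable : Biextendable S
      reduced      : S ⊆ Reduced
      symmetric    : IsSymmetric Gθ ⟪ S ⟫

  record IsSpecular (S : Language A) : Set₁ where
    field
      laminary : IsLaminary S
      treeSet  : IsTreeSet S 2

{-# OPTIONS --safe #-}
-- Folding the petals of the flower of X along their common prefixes and
-- suffixes gives the Stallings automaton of the group generated by X.
-- Since the extension graphs of S are forests, two cuts of elements of X
-- that are identified and can both be continued by a letter a are
-- identified by a walk along which every cut is continued by a
-- (zigzag-head). Hence no further identification takes place: X is a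
-- monoidal basis of the group it generates, and a word of S lies in this
-- group only if it is in X*, so that the suffixes of a word of S without
-- prefix in X lie in distinct cosets. For a long word, when every long
-- word of S has a prefix in X, they meet all cosets: the union of the
-- cosets is carried along when the word slides over S, and the
-- extension graphs being connected (in the case of ℰ(ε), after its two
-- trees have been exchanged by inversion), it is invariant under the
-- whole group. Hence the index is the number of parses of a long word.
-- Finally, every long word has a prefix in X if X is maximal, since
-- otherwise some u v u⁻¹ could be added to X, and also if the index is
-- finite, by a pigeonhole argument on the words u v₁ u v₂ u ….

module Submission where

open import Defs
open import Level using (0ℓ)
open import Algebra.Bundles using (Group)
open import Data.Empty using (⊥; ⊥-elim)
open import Data.Unit.Base using (⊤; tt)
open import Data.Fin.Base using (Fin; zero; suc; toℕ)
import Data.Fin.Properties as Fin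
open import Data.List.Base using (List; []; _∷_; [_]; _++_; concat; foldr; length; map; drop; _ʳ++_; take; lookup; initLast; _∷ʳ′_)
import Data.List.Properties as List
import Data.List.Relation.Binary.Prefix.Heterogeneous.Properties as PrefixProperties
import Data.List.Relation.Binary.Suffix.Heterogeneous.Properties as SuffixProperties
open import Data.List.Membership.Propositional using (find; lose) renaming (_∈_ to _∈ₗ_; _∉_ to _∉ₗ_)
import Data.List.Membership.Propositional.Properties as Mem
open import Data.List.Relation.Binary.Infix.Heterogeneous as Infix using (here; there)
open import Data.List.Relation.Binary.Prefix.Heterogeneous as Prefix using ([]; _∷_)
open import Data.List.Relation.Binary.Suffix.Heterogeneous as Suffix using ()
open import Data.List.Relation.Binary.Pointwise as Pointwise using (Pointwise; []; _∷_)
open import Data.List.Relation.Unary.All as All using (All; []; _∷_)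
import Data.List.Relation.Unary.All.Properties as All
import Data.List.Relation.Unary.Any.Properties as Any
import Data.List.Relation.Unary.Unique.Propositional.Properties as Unique
open import Data.List.Relation.Unary.Any as Any using (here; there)
open import Data.List.Relation.Unary.AllPairs using ([]; _∷_)
open import Data.List.Relation.Unary.Linked as Linked using (Linked; []; [-]; _∷_)
open import Data.List.Relation.Unary.Unique.Propositional using (Unique)
open import Data.Nat.Base using (ℕ; zero; suc; _+_; _∸_; _≤_; _<_; z≤n; s≤s)
import Data.Nat.Properties as ℕ
open import Data.Nat.Induction using (<-rec)
open import Data.Product.Base using (Σ-syntax; _×_; _,_; proj₁; proj₂; ∃; ∃₂; ∃-syntax)
open import Data.Sum.Base as Sum using (_⊎_; inj₁; inj₂)
import Data.Sum.Properties as Sum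
open import Function.Base using (_∘_; id; _$_)
open import Function.Bundles using (_↔_; _⇔_; Injection; Inverse; Equivalence; mk⇔)
import Function.Properties.Equivalence as ⇔
open import Function.Properties.Inverse using (Inverse⇒Injection; ↔⇒↣)
open import Relation.Binary.Bundles using (Setoid)
open import Relation.Binary.Core using (Rel)
open import Relation.Binary.Definitions using (DecidableEquality)
open import Relation.Binary.Construct.Closure.ReflexiveTransitive as Star using (Star; ε; _◅_; _◅◅_)
open import Relation.Binary.PropositionalEquality using (_≡_; _≢_; refl; sym; trans; cong; cong₂; subst; subst₂)
open import Relation.Nullary using (¬_; Dec; yes; no; contradiction)
open import Relation.Unary using (Pred; _∈_; _∉_; _⊆_; _≐_)

-- An inner point of a petal is met twice, as a cut of an element of `X` and as a cut of its
-- inverse. Folding might therefore glue a cut to the inverse of another one that is continued by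
-- the same letter. The two letters at a cut form an edge of ℰ(ε), and inversion exchanges the two
-- trees of ℰ(ε); this rules the accident out. The automaton is set up over a set `Φ` of base
-- points. A single base point gives the flower and the assertion on words of `S`. Formal reduced
-- products as base points give a covering of the flower: there a product that is trivial in `Gθ`
-- must end where it started, so it is formally trivial, which is freeness. One proof of determinism
-- serves both. Languages are arbitrary predicates. Membership in `S` is never decided; searches run
-- over the finite list of elements of `X`.

-- Cancellation over an alphabet with an involution

module Stack {L : Set} (_≟_ : DecidableEquality L) (ι : L → L) (ι-involutive : ∀ a → ι (ι a) ≡ a) where

  -- The alphabet is a parameter because cancellation occurs on two levels: for letters under `θ`,
  -- and for whole words under `inv`, where lists of words are formal products.
  push : L → List L → List L
  push a [] = [ a ]
  push a (b ∷ r) with b ≟ ι a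
  ... | yes _ = r
  ... | no  _ = a ∷ b ∷ r

  NoCancellation : List L → Set
  NoCancellation = Linked (λ a b → b ≢ ι a)

  push-noCancellation : ∀ a {r} → NoCancellation r → NoCancellation (push a r)
  push-noCancellation a [] = [-]
  push-noCancellation a {b ∷ r} nc with b ≟ ι a
  ... | yes _   = Linked.tail nc
  ... | no  b≢ = b≢ ∷ nc

  push-∷ : ∀ a {r} → NoCancellation (a ∷ r) → push a r ≡ a ∷ r
  push-∷ a [-] = refl
  push-∷ a {b ∷ r} (b≢ ∷ nc) with b ≟ ι a
  ... | yes b≡ = contradiction b≡ b≢
  ... | no  _  = refl

  push-ι-∷ : ∀ a r → push (ι a) (a ∷ r) ≡ r
  push-ι-∷ a r with a ≟ ι (ι a)
  ... | yes _ = refl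
  ... | no a≢ = contradiction (sym (ι-involutive a)) a≢

  push-ι-push : ∀ a {r} → NoCancellation r → push (ι a) (push a r) ≡ r
  push-ι-push a [] = push-ι-∷ a []
  push-ι-push a {b ∷ r} nc with b ≟ ι a
  ... | yes refl = push-∷ (ι a) nc
  ... | no  _    = push-ι-∷ a (b ∷ r)

  push-push-ι : ∀ a {r} → NoCancellation r → push a (push (ι a) r) ≡ r
  push-push-ι a {r} nc =
    subst (λ b → push b (push (ι a) r) ≡ r) (ι-involutive a) (push-ι-push (ι a) nc)

  foldr-push-id : ∀ {w} → NoCancellation w → foldr push [] w ≡ w
  foldr-push-id {[]}    _  = refl
  foldr-push-id {a ∷ w} nc =
    trans (cong (push a) (foldr-push-id (Linked.tail nc))) (push-∷ a nc)

-- Normal forms in `Gθ`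

module Presented {A : Set} (_≟_ : DecidableEquality A) (θ : A → A) (θ-involutive : ∀ a → θ (θ a) ≡ a) where

  open Stack _≟_ θ θ-involutive public
  open import Algebra.Properties.Group (Gθ θ) using (⁻¹-anti-homo-∙; inverseʳ-unique; ε⁻¹≈ε)
  open import Relation.Binary.Reasoning.Setoid (Group.setoid (Gθ θ))

  -- The form with `ʳ++` suits words stored as a reversed piece and an unreversed one: inversion
  -- then just exchanges the two pieces (`inv-ʳ++`).
  inv : Word A → Word A
  inv w = map θ w ʳ++ []

  map-θ-involutive : ∀ w → map θ (map θ w) ≡ w
  map-θ-involutive []      = refl
  map-θ-involutive (a ∷ w) = cong₂ _∷_ (θ-involutive a) (map-θ-involutive w)

  inv-ʳ++ : ∀ u v → inv (u ʳ++ v) ≡ map θ v ʳ++ map θ u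
  inv-ʳ++ u v =
    trans (cong (_ʳ++ []) (List.map-ʳ++ θ u))
      (trans (List.ʳ++-ʳ++ (map θ u)) (cong (map θ v ʳ++_) (List.++-identityʳ (map θ u))))

  inv-++ : ∀ u v → inv (u ++ v) ≡ inv v ++ inv u
  inv-++ u v =
    trans (cong (_ʳ++ []) (List.map-++ θ u v))
      (trans (List.++-ʳ++ (map θ u))
        (trans (List.ʳ++-defn (map θ v)) (cong (_++ inv u) (sym (trans (List.ʳ++-defn (map θ v)) (List.++-identityʳ _))))))

  inv-involutive : ∀ w → inv (inv w) ≡ w
  inv-involutive w =
    trans (inv-ʳ++ (map θ w) []) (map-θ-involutive w)

  length-inv : ∀ w → length (inv w) ≡ length w
  length-inv w =
    trans (List.length-ʳ++ (map θ w)) (trans (ℕ.+-identityʳ _) (List.length-map θ w))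

  -- A group term acts on reduced words by left multiplication; this is
  -- the van der Waerden proof that reduced words are normal forms.
  act act⁻ : Expr A → Word A → Word A
  act (gen a) r = push a r
  act one     r = r
  act (g · h) r = act g (act h r)
  act (g ⁻)   r = act⁻ g r
  act⁻ (gen a) r = push (θ a) r
  act⁻ one     r = r
  act⁻ (g · h) r = act⁻ h (act⁻ g r)
  act⁻ (g ⁻)   r = act g r

  act-noCancellation  : ∀ g {r} → NoCancellation r → NoCancellation (act g r)
  act⁻-noCancellation : ∀ g {r} → NoCancellation r → NoCancellation (act⁻ g r)
  act-noCancellation (gen a) nc = push-noCancellation a nc
  act-noCancellation one     nc = nc
  act-noCancellation (g · h) nc = act-noCancellation g (act-noCancellation h nc)
  act-noCancellation (g ⁻)   nc = act⁻-noCancellation g nc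
  act⁻-noCancellation (gen a) nc = push-noCancellation (θ a) nc
  act⁻-noCancellation one     nc = nc
  act⁻-noCancellation (g · h) nc = act⁻-noCancellation h (act⁻-noCancellation g nc)
  act⁻-noCancellation (g ⁻)   nc = act-noCancellation g nc

  act⁻-act : ∀ g {r} → NoCancellation r → act⁻ g (act g r) ≡ r
  act-act⁻ : ∀ g {r} → NoCancellation r → act g (act⁻ g r) ≡ r
  act⁻-act (gen a) nc = push-ι-push a nc
  act⁻-act one     nc = refl
  act⁻-act (g · h) nc = trans (cong (act⁻ h) (act⁻-act g (act-noCancellation h nc))) (act⁻-act h nc)
  act⁻-act (g ⁻)   nc = act-act⁻ g nc
  act-act⁻ (gen a) nc = push-push-ι a nc
  act-act⁻ one     nc = refl
  act-act⁻ (g · h) nc = trans (cong (act g) (act-act⁻ h (act⁻-noCancellation g nc))) (act-act⁻ g nc)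
  act-act⁻ (g ⁻)   nc = act⁻-act g nc

  -- The restriction on `r` matters: on `θ a ∷ a ∷ []`, pushing `a` and then `θ a` gives `[]`, so
  -- the relations act trivially only on words without cancellation.
  act-cong  : ∀ {g h} → _~_ θ g h → ∀ {r} → NoCancellation r → act g r ≡ act h r
  act⁻-cong : ∀ {g h} → _~_ θ g h → ∀ {r} → NoCancellation r → act⁻ g r ≡ act⁻ h r
  act-cong (relation a)    nc = push-push-ι a nc
  act-cong ~-refl          nc = refl
  act-cong (~-sym p)       nc = sym (act-cong p nc)
  act-cong (~-trans p q)   nc = trans (act-cong p nc) (act-cong q nc)
  act-cong (·-cong {g} {g′} {h} {h′} p q) nc =
    trans (cong (act g) (act-cong q nc)) (act-cong p (act-noCancellation h′ nc))
  act-cong (⁻-cong p)      nc = act⁻-cong p nc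
  act-cong (·-assoc _ _ _) nc = refl
  act-cong (identityˡ _)   nc = refl
  act-cong (identityʳ _)   nc = refl
  act-cong (inverseˡ g)    nc = act⁻-act g nc
  act-cong (inverseʳ g)    nc = act-act⁻ g nc
  act⁻-cong (relation a)   nc = push-ι-push (θ a) nc
  act⁻-cong ~-refl         nc = refl
  act⁻-cong (~-sym p)      nc = sym (act⁻-cong p nc)
  act⁻-cong (~-trans p q)  nc = trans (act⁻-cong p nc) (act⁻-cong q nc)
  act⁻-cong (·-cong {g} {g′} {h} {h′} p q) nc =
    trans (cong (act⁻ h) (act⁻-cong p nc)) (act⁻-cong q (act⁻-noCancellation g′ nc))
  act⁻-cong (⁻-cong p)      nc = act-cong p nc
  act⁻-cong (·-assoc _ _ _) nc = refl
  act⁻-cong (identityˡ _)   nc = refl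
  act⁻-cong (identityʳ _)   nc = refl
  act⁻-cong (inverseˡ g)    nc = act⁻-act g nc
  act⁻-cong (inverseʳ g)    nc = act-act⁻ g nc

  act-⟦⟧ : ∀ w r → act ⟦ w ⟧ r ≡ foldr push r w
  act-⟦⟧ []      r = refl
  act-⟦⟧ (a ∷ w) r = cong (push a) (act-⟦⟧ w r)

  ⟦⟧-~⇒≡ : ∀ {u v} → NoCancellation v → _~_ θ ⟦ u ⟧ ⟦ v ⟧ → foldr push [] u ≡ v
  ⟦⟧-~⇒≡ {u} {v} nv p =
    trans (sym (act-⟦⟧ u [])) (trans (act-cong p []) (trans (act-⟦⟧ v []) (foldr-push-id nv)))

  ⟦⟧-injective : ∀ {u v} → NoCancellation u → NoCancellation v → _~_ θ ⟦ u ⟧ ⟦ v ⟧ → u ≡ v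
  ⟦⟧-injective {u} nu nv p = trans (sym (foldr-push-id nu)) (⟦⟧-~⇒≡ {u} nv p)

  ⟦⟧-++ : ∀ u v → _~_ θ ⟦ u ++ v ⟧ (⟦ u ⟧ · ⟦ v ⟧)
  ⟦⟧-++ []      v = ~-sym (identityˡ _)
  ⟦⟧-++ (a ∷ u) v = ~-trans (·-cong ~-refl (⟦⟧-++ u v)) (~-sym (·-assoc _ _ _))

  ⟦⟧-map-ʳ++ : ∀ w r → _~_ θ ⟦ map θ w ʳ++ r ⟧ (⟦ w ⟧ ⁻ · ⟦ r ⟧)
  ⟦⟧-map-ʳ++ [] r = ~-sym (~-trans (·-cong ε⁻¹≈ε ~-refl) (identityˡ _))
  ⟦⟧-map-ʳ++ (a ∷ w) r = begin
    ⟦ map θ w ʳ++ (θ a ∷ r) ⟧        ≈⟨ ⟦⟧-map-ʳ++ w (θ a ∷ r) ⟩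
    ⟦ w ⟧ ⁻ · (gen (θ a) · ⟦ r ⟧)    ≈⟨ ~-sym (·-assoc _ _ _) ⟩
    ⟦ w ⟧ ⁻ · gen (θ a) · ⟦ r ⟧      ≈⟨ ·-cong (·-cong ~-refl (inverseʳ-unique (gen a) (gen (θ a)) (relation a))) ~-refl ⟩
    ⟦ w ⟧ ⁻ · gen a ⁻ · ⟦ r ⟧        ≈⟨ ·-cong (~-sym (⁻¹-anti-homo-∙ (gen a) ⟦ w ⟧)) ~-refl ⟩
    (gen a · ⟦ w ⟧) ⁻ · ⟦ r ⟧        ∎

  ⟦⟧-inv : ∀ w → _~_ θ ⟦ inv w ⟧ (⟦ w ⟧ ⁻)
  ⟦⟧-inv w = ~-trans (⟦⟧-map-ʳ++ w []) (identityʳ _)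

  reduced⇒noCancellation : ∀ {w} → Reduced θ w → NoCancellation w
  reduced⇒noCancellation {[]}        red = []
  reduced⇒noCancellation {a ∷ []}    red = [-]
  reduced⇒noCancellation {a ∷ b ∷ w} red =
    (λ b≡ → red a (here (refl ∷ sym b≡ ∷ []))) ∷
    reduced⇒noCancellation (λ c → red c ∘ there)

  inv-noCancellation : ∀ {w} → NoCancellation w → NoCancellation (inv w)
  inv-noCancellation {[]}    _  = []
  inv-noCancellation {a ∷ w} nc = go a w nc [-]
    where
    go : ∀ a w {r} → NoCancellation (a ∷ w) → NoCancellation (θ a ∷ r) → NoCancellation (map θ w ʳ++ (θ a ∷ r))
    go a []      _         nr = nr
    go a (b ∷ w) (b≢ ∷ nc) nr =
      go b w nc ((λ θa≡ → b≢ (trans (sym (θ-involutive b)) (sym θa≡))) ∷ nr)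

  symmetric⇒inv-closed : ∀ {Y : Language A} → Y ⊆ Reduced θ → IsSymmetric (Gθ θ) (⟪_⟫ θ Y) →
    ∀ {w} → w ∈ Y → inv w ∈ Y
  symmetric⇒inv-closed {Y} red symm {w} w∈Y with symm (w , w∈Y , ~-refl)
  ... | w′ , w′∈Y , w′~ = subst Y
    (⟦⟧-injective (reduced⇒noCancellation (red w′∈Y))
      (inv-noCancellation (reduced⇒noCancellation (red w∈Y)))
      (~-trans w′~ (~-sym (⟦⟧-inv w)))) w′∈Y

-- Walks in acyclic graphs

module Acyclic {V : Set} (_≟_ : DecidableEquality V) (G : Graph V) (acyclic : ¬ Cycle G) where
  open Graph G
  open import Data.List.Membership.DecPropositional _≟_ using (_∈?_)

  Avoiding : V → Rel V 0ℓ
  Avoiding a u v = Edge u v × u ≢ a × v ≢ a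

  data SimplePath (a q : V) : List V → Set where
    end : q ≢ a → SimplePath a q [ q ]
    _∷_ : ∀ {u v vs} → Edge u v × u ≢ a × u ∉ₗ v ∷ vs → SimplePath a q (v ∷ vs) → SimplePath a q (u ∷ v ∷ vs)

  from : ∀ {a q u vs} → u ∈ₗ vs → SimplePath a q vs → ∃[ us ] SimplePath a q (u ∷ us)
  from (here refl) p@(end _) = _ , p
  from (here refl) p@(_ ∷ _) = _ , p
  from (there u∈)  (_ ∷ p)   = from u∈ p

  loopErase : ∀ {a p q} → q ≢ a → Star (Avoiding a) p q → ∃[ vs ] SimplePath a q (p ∷ vs)
  loopErase q≢a ε = _ , end q≢a
  loopErase {p = p} q≢a (_◅_ {j = v} (e , p≢a , _) es) with loopErase q≢a es
  ... | vs , π with p ∈? v ∷ vs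
  ...   | yes p∈ = from p∈ π
  ...   | no  p∉ = _ , (e , p≢a , p∉) ∷ π

  unique : ∀ {a q vs} → SimplePath a q vs → Unique vs × All (a ≢_) vs
  unique (end q≢a)              = [] ∷ [] , (q≢a ∘ sym) ∷ []
  unique ((e , u≢a , u∉) ∷ π) =
    All.¬Any⇒All¬ _ u∉ ∷ proj₁ (unique π) , (u≢a ∘ sym) ∷ proj₂ (unique π)

  linked : ∀ {a q vs} → SimplePath a q vs → Edge q a → Linked Edge (vs ++ [ a ])
  linked (end _)         qa = qa ∷ [-]
  linked ((e , _) ∷ π) qa = e ∷ linked π qa

  -- Erasing loops leaves a simple path from `p` to `q` that avoids `a`; if it had more than one
  -- vertex, it would close up through `a` to a cycle.
  return-edge : ∀ {a p q} → Edge a p → Edge a q → Star (Avoiding a) p q → p ≡ q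
  return-edge {a} {p} {q} ap aq π with loopErase (λ { refl → edge-irrefl aq }) π
  ... | []     , end _ = refl
  ... | v ∷ vs , σ     = ⊥-elim (acyclic
    (a , p ∷ v ∷ vs , proj₂ (unique σ) ∷ proj₁ (unique σ) , s≤s (s≤s (s≤s z≤n)) , ap ∷ linked σ (edge-sym aq)))

chain : {V : Set} {R : Rel V 0ℓ} (v : ℕ → V) → ∀ n → (∀ k → k < n → R (v k) (v (suc k))) → Star R (v 0) (v n)
chain v zero    e = ε
chain v (suc n) e = e 0 (s≤s z≤n) ◅ chain (v ∘ suc) n (λ k k<n → e (suc k) (s≤s k<n))

unchain : {V : Set} {R : Rel V 0ℓ} {p q : V} → Star R p q →
  ∃[ n ] Σ[ v ∈ (ℕ → V) ] v 0 ≡ p × v n ≡ q × (∀ k → k < n → R (v k) (v (suc k)))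
unchain {p = p} ε = 0 , (λ _ → p) , refl , refl , λ _ ()
unchain {p = p} (e ◅ es) with unchain es
... | n , v , refl , refl , es′ = suc n , v′ , refl , refl , λ { zero _ → e ; (suc k) (s≤s k<n) → es′ k k<n }
  where
  v′ : ℕ → _
  v′ zero    = p
  v′ (suc k) = v k

-- The two trees of ℰ(ε)

module Specular {A : Set} (_≟_ : DecidableEquality A) (θ : A → A) (θ-involutive : ∀ a → θ (θ a) ≡ a)
  (S : Language A) (specular : IsSpecular θ S) where

  open Presented _≟_ θ θ-involutive public
  open IsSpecular specular
  open IsLaminary laminary using () renaming (reduced to S-reduced; symmetric to S-symmetric) public
  open IsTreeSet treeSet using (extendable; tree; forest) renaming (factorial to S-factorial) public
  open Factorial S-factorial public
  open IsDisjointUnionOfTrees forest public using (component; disjoint)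
    renaming (tree to component-tree; vertices to component-vertices; edges to component-edges)

  S-inv : ∀ {w} → w ∈ S → inv w ∈ S
  S-inv = symmetric⇒inv-closed S-reduced S-symmetric

  infix-S : ∀ u {w} v → u ++ w ++ v ∈ S → w ∈ S
  infix-S u v = factors (Infix.fromView (Infix.MkView u (Pointwise.refl refl) v))

  suffix-S : ∀ u {w} → u ++ w ∈ S → w ∈ S
  suffix-S u {w} uw∈S = infix-S u [] (subst (λ z → u ++ z ∈ S) (sym (List.++-identityʳ w)) uw∈S)

  prefix-S : ∀ w v → w ++ v ∈ S → w ∈ S
  prefix-S w v = infix-S [] v

  ʳ++-suffix-S : ∀ u {w} → u ʳ++ w ∈ S → w ∈ S
  ʳ++-suffix-S []      w∈S  = w∈S
  ʳ++-suffix-S (a ∷ u) uw∈S = suffix-S [ a ] (ʳ++-suffix-S u uw∈S)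

  someLetter : A
  someLetter = Sum.reduce (proj₁ (IsTree.nonempty (component-tree zero)))

  []∈S : [] ∈ S
  []∈S = suffix-S [ someLetter ] (letters someLetter)

  E : Word A → Rel (A ⊎ A) 0ℓ
  E w = Graph.Edge (ℰ S-factorial w)

  _≟ⱽ_ : DecidableEquality (A ⊎ A)
  _≟ⱽ_ = Sum.≡-dec _≟_ _≟_

  -- By disjointness an edge that starts in a component stays in it, so a cycle of ℰ(ε) would be a
  -- cycle of a single tree.
  component-linked : ∀ {i u us} → Graph.Vertex (component i) u → Linked (E []) (u ∷ us) → Linked (Graph.Edge (component i)) (u ∷ us)
  component-linked _ [-] = [-]
  component-linked {i} {u} {w ∷ us} vu (e ∷ es) with Equivalence.to (component-edges u w) e
  ... | j , eⱼ with disjoint i j u vu (Graph.edge-vertex (component j) eⱼ)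
  ...   | refl = eⱼ ∷ component-linked (Graph.edge-vertex (component i) (Graph.edge-sym (component i) eⱼ)) es

  ℰ-acyclic : ∀ w → w ∈ S → ¬ Cycle (ℰ S-factorial w)
  ℰ-acyclic (a ∷ w) w∈S cycle = IsTree.acyclic (tree (a ∷ w) w∈S λ ()) cycle
  ℰ-acyclic [] _ (v , [] , _ , s≤s () , _)
  ℰ-acyclic [] _ (v , u ∷ us , uniq , len , e ∷ es) with Equivalence.to (component-edges v u) e
  ... | i , eᵢ = IsTree.acyclic (component-tree i)
    (v , u ∷ us , uniq , len , component-linked (Graph.edge-vertex (component i) eᵢ) (e ∷ es))

  return-edge : ∀ w → w ∈ S → ∀ {a p q} → E w a p → E w a q →
    Star (λ u v → E w u v × u ≢ a × v ≢ a) p q → p ≡ q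
  return-edge w w∈S = Acyclic.return-edge _≟ⱽ_ (ℰ S-factorial w) (ℰ-acyclic w w∈S)

  vertex : ∀ v → Graph.Vertex (ℰ S-factorial []) v
  vertex (inj₁ a) = letters a
  vertex (inj₂ a) = letters a

  side : A ⊎ A → Fin 2
  side v = proj₁ (Equivalence.to (component-vertices v) (vertex v))

  side-vertex : ∀ v → Graph.Vertex (component (side v)) v
  side-vertex v = proj₂ (Equivalence.to (component-vertices v) (vertex v))

  E⇒side≡ : ∀ {u v} → E [] u v → side u ≡ side v
  E⇒side≡ {u} {v} e with Equivalence.to (component-edges u v) e
  ... | i , eᵢ = trans (disjoint _ i u (side-vertex u) (Graph.edge-vertex (component i) eᵢ))
    (sym (disjoint _ i v (side-vertex v) (Graph.edge-vertex (component i) (Graph.edge-sym (component i) eᵢ))))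

  side≡⇒connected : ∀ u v → side u ≡ side v → Star (E []) u v
  side≡⇒connected u v eq =
    Star.map (λ {x} {y} e → Equivalence.from (component-edges x y) (_ , e))
      (IsTree.connected (component-tree (side u)) u v (side-vertex u)
        (subst (λ i → Graph.Vertex (component i) v) (sym eq) (side-vertex v)))

  -- The effect of inverting two-letter words of `S` on the vertices of ℰ(ε).
  σ : A ⊎ A → A ⊎ A
  σ (inj₁ a) = inj₂ (θ a)
  σ (inj₂ a) = inj₁ (θ a)

  σ-involutive : ∀ v → σ (σ v) ≡ v
  σ-involutive (inj₁ a) = cong inj₁ (θ-involutive a)
  σ-involutive (inj₂ a) = cong inj₂ (θ-involutive a)

  σ-≢ : ∀ v → σ v ≢ v
  σ-≢ (inj₁ _) ()
  σ-≢ (inj₂ _) ()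

  E-sym : ∀ w {u v} → E w u v → E w v u
  E-sym w {u} {v} = Graph.edge-sym (ℰ S-factorial w) {u} {v}

  E-σ : ∀ u v → E [] u v → E [] (σ u) (σ v)
  E-σ (inj₁ a) (inj₂ b) e = S-inv e
  E-σ (inj₂ b) (inj₁ a) e = S-inv e

  ¬E-σ : ∀ v → ¬ E [] v (σ v)
  ¬E-σ (inj₁ a) e = S-reduced e a (here (refl ∷ refl ∷ []))
  ¬E-σ (inj₂ a) e = S-reduced e (θ a) (here (refl ∷ θ-involutive a ∷ []))

  -- A shortest walk from a vertex v to σ v followed by its image under
  -- σ would be a closed walk without backtracking.
  ¬walk-σ : ∀ N n → n ≤ N → (v : ℕ → A ⊎ A) → (∀ k → k < n → E [] (v k) (v (suc k))) → v n ≢ σ (v 0)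
  ¬walk-σ N zero _ v e eq = σ-≢ (v 0) (sym eq)
  ¬walk-σ N (suc zero) _ v e eq = ¬E-σ (v 0) (subst (E [] (v 0)) eq (e 0 (s≤s z≤n)))
  ¬walk-σ (suc N) (suc (suc m)) (s≤s n≤N) v e eq
    with ℕ.anyUpTo? (λ k → v (suc k) ≟ⱽ v 0) (suc m)
       | ℕ.anyUpTo? (λ k → v (suc k) ≟ⱽ σ (v 0)) (suc m)
  ... | yes (k , k<m , vk≡) | _ =
    ¬walk-σ N (suc m ∸ k) (ℕ.≤-trans (ℕ.m∸n≤m (suc m) k) n≤N) (λ j → v (suc (k + j)))
      (λ j j<n → subst (λ i → E [] (v (suc (k + j))) (v (suc i))) (sym (ℕ.+-suc k j))
        (e (suc (k + j)) (s≤s (subst (k + j <_) k+ (ℕ.+-monoʳ-< k j<n)))))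
      (trans (cong (v ∘ suc) k+) (trans eq (cong σ (trans (sym vk≡) (cong (v ∘ suc) (sym (ℕ.+-identityʳ k)))))))
    where
    k+ : k + (suc m ∸ k) ≡ suc m
    k+ = ℕ.m+[n∸m]≡n (ℕ.<⇒≤ k<m)
  ... | no _ | yes (k , k<m , vk≡) =
    ¬walk-σ N (suc k) (ℕ.≤-trans k<m n≤N) v (λ j j<k → e j (ℕ.<-trans j<k (s≤s k<m))) vk≡
  ... | no avoid | no avoidσ =
    ¬walk-σ N m (ℕ.≤-trans (ℕ.n≤1+n m) n≤N) (v ∘ suc) (λ k k<m → e (suc k) (s≤s (ℕ.m≤n⇒m≤1+n k<m)))
      (trans (sym (σ-involutive (v (suc m)))) (cong σ (sym v₁≡)))
    where
    ≢v₀ : ∀ k → k ≤ m → v (suc k) ≢ v 0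
    ≢v₀ k k≤m p = avoid (k , s≤s k≤m , p)

    σ≢v₀ : ∀ k → k ≤ m → σ (v (suc k)) ≢ v 0
    σ≢v₀ k k≤m p = avoidσ (k , s≤s k≤m , trans (sym (σ-involutive (v (suc k)))) (cong σ p))

    last-edge : E [] (v (suc m)) (σ (v 0))
    last-edge = subst (E [] (v (suc m))) eq (e (suc m) ℕ.≤-refl)

    -- `return-edge` applies since the walk from `v 1` on, continued by its image under `σ`, avoids
    -- `v 0`. Both ends can then be stripped off, which leaves a shorter walk from `v 1` to
    -- `σ (v 1)`.
    v₁≡ : v 1 ≡ σ (v (suc m))
    v₁≡ = return-edge [] []∈S (e 0 (s≤s z≤n))
      (E-sym [] {σ (v (suc m))} (subst (E [] (σ (v (suc m)))) (σ-involutive (v 0)) (E-σ (v (suc m)) (σ (v 0)) last-edge)))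
      (chain (v ∘ suc) m (λ k k<m → e (suc k) (s≤s (ℕ.m≤n⇒m≤1+n k<m)) , ≢v₀ k (ℕ.<⇒≤ k<m) , ≢v₀ (suc k) k<m)
       ◅◅ (last-edge , ≢v₀ m ℕ.≤-refl , σ-≢ (v 0))
       ◅ (E-σ (v 0) (v 1) (e 0 (s≤s z≤n)) , σ-≢ (v 0) , σ≢v₀ 0 z≤n)
       ◅ chain (σ ∘ v ∘ suc) m (λ k k<m → E-σ (v (suc k)) (v (suc (suc k))) (e (suc k) (s≤s (ℕ.m≤n⇒m≤1+n k<m))) , σ≢v₀ k (ℕ.<⇒≤ k<m) , σ≢v₀ (suc k) k<m))

  -- Used twice: to keep cuts apart from inverse cuts in the automaton, and to pass from one tree of
  -- ℰ(ε) to the other by inversion.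
  side-σ : ∀ v → side v ≢ side (σ v)
  side-σ v eq with unchain (side≡⇒connected v (σ v) eq)
  ... | n , u , refl , un≡ , e = ¬walk-σ n n ℕ.≤-refl u e un≡

-- Walks of two-sided extensions

data Side : Set where
  left right : Side

opposite : Side → Side
opposite left  = right
opposite right = left

module Zigzags {A : Set} (_≟_ : DecidableEquality A) (θ : A → A) (θ-involutive : ∀ a → θ (θ a) ≡ a)
  (S : Language A) (specular : IsSpecular θ S) where

  open Specular _≟_ θ θ-involutive S specular

  infix 4 _#_

  -- The words branch: neither is a prefix of the other. Distinct rests of elements of a bifix code
  -- are of this kind, and the relation survives the removal of a common first letter.
  data _#_ : Rel (Word A) 0ℓ where
    differ : ∀ {a b u v} → a ≢ b → a ∷ u # b ∷ v
    skip   : ∀ {c u v} → u # v → c ∷ u # c ∷ v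

  #-compare : ∀ u v → (∃[ t ] v ≡ u ++ t) ⊎ (∃[ t ] u ≡ v ++ t) ⊎ u # v
  #-compare []      v       = inj₁ (v , refl)
  #-compare (a ∷ u) []      = inj₂ (inj₁ (a ∷ u , refl))
  #-compare (a ∷ u) (b ∷ v) with a ≟ b
  ... | no a≢b = inj₂ (inj₂ (differ a≢b))
  ... | yes refl with #-compare u v
  ...   | inj₁ (t , eq)        = inj₁ (t , cong (a ∷_) eq)
  ...   | inj₂ (inj₁ (t , eq)) = inj₂ (inj₁ (t , cong (a ∷_) eq))
  ...   | inj₂ (inj₂ u#v)      = inj₂ (inj₂ (skip u#v))

  #-tail : ∀ {c u v} → c ∷ u # c ∷ v → u # v
  #-tail (differ c≢c) = contradiction refl c≢c
  #-tail (skip u#v)   = u#v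

  -- The default letter only makes the function total.
  hd : Word A → A
  hd []      = someLetter
  hd (a ∷ _) = a

  -- An equation, so that it is decided by comparing words and can be used directly in `subst`.
  Head : A → Word A → Set
  Head a u = u ≡ a ∷ drop 1 u

  #⇒Headˡ : ∀ {u v} → u # v → Head (hd u) u
  #⇒Headˡ (differ _) = refl
  #⇒Headˡ (skip _)   = refl

  #⇒Headʳ : ∀ {u v} → u # v → Head (hd v) v
  #⇒Headʳ (differ _) = refl
  #⇒Headʳ (skip _)   = refl

  -- x is a word read away from w on side s, and y one on the other side.
  Span : Side → Word A → Rel (Word A) 0ℓ
  Span left  w x y = x ʳ++ (w ++ y) ∈ S
  Span right w x y = y ʳ++ (w ++ x) ∈ S

  Span-opposite : ∀ s {w x y} → Span s w x y → Span (opposite s) w y x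
  Span-opposite left  p = p
  Span-opposite right p = p

  tag : Side → A → A ⊎ A
  tag left  = inj₁
  tag right = inj₂

  tag-injective : ∀ s {a b} → tag s a ≡ tag s b → a ≡ b
  tag-injective left  refl = refl
  tag-injective right refl = refl

  tag-opposite : ∀ s {a b} → tag (opposite s) b ≢ tag s a
  tag-opposite left  ()
  tag-opposite right ()

  J⇒B : ∀ {a b} u w v → (a ∷ u) ʳ++ (w ++ b ∷ v) ∈ S → (a , b) ∈ B S w
  J⇒B {a} {b} u w v p = prefix-S (a ∷ w ++ [ b ]) v
    (subst (_∈ S) (cong (a ∷_) (sym (List.++-assoc w [ b ] v))) (ʳ++-suffix-S u p))

  Span⇒E : ∀ s {w x y a b} → Head a x → Head b y → Span s w x y → E w (tag s a) (tag (opposite s) b)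
  Span⇒E left  {w} {a ∷ x} {b ∷ y} refl refl p = J⇒B x w y p
  Span⇒E right {w} {a ∷ x} {b ∷ y} refl refl p = J⇒B y w x p

  Span⇒S : ∀ s {w x y} → Span s w x y → w ∈ S
  Span⇒S left  {w} {x} {y} p = prefix-S w y (ʳ++-suffix-S x p)
  Span⇒S right {w} {x} {y} p = prefix-S w x (ʳ++-suffix-S y p)

  extend : Side → A → Word A → Word A
  extend left  c w = w ++ [ c ]
  extend right c w = c ∷ w

  Span-shift : ∀ s {w x y c} → Head c y → Span s w x y → Span s (extend s c w) x (drop 1 y)
  Span-shift left  {w} {x} {c ∷ y} refl p = subst (λ z → x ʳ++ z ∈ S) (sym (List.++-assoc w [ c ] y)) p
  Span-shift right {y = c ∷ y} refl p = p

  -- A walk without backtracking x₀ y₀ x₁ … yₙ₋₁ xₙ in the bipartite graph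
  -- of two-sided extensions of w by words.
  record Zigzag (s : Side) (w : Word A) (n : ℕ) (x y : ℕ → Word A) : Set where
    field
      up   : ∀ k → k < n → Span s w (x k) (y k)
      down : ∀ k → k < n → Span s w (x (suc k)) (y k)
      x-#  : ∀ k → k < n → x k # x (suc k)
      y-#  : ∀ k → suc k < n → y k # y (suc k)

  open Zigzag

  take-zigzag : ∀ {s w n m x y} → m ≤ n → Zigzag s w n x y → Zigzag s w m x y
  take-zigzag m≤n z = record
    { up   = λ k k< → up z k (ℕ.≤-trans k< m≤n)
    ; down = λ k k< → down z k (ℕ.≤-trans k< m≤n)
    ; x-#  = λ k k< → x-# z k (ℕ.≤-trans k< m≤n)
    ; y-#  = λ k k< → y-# z k (ℕ.≤-trans k< m≤n)
    }

  drop-zigzag : ∀ {s w} m i {x y} → Zigzag s w (m + i) x y → Zigzag s w m (x ∘ (_+ i)) (y ∘ (_+ i))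
  drop-zigzag m i z = record
    { up   = λ k k< → up z (k + i) (ℕ.+-monoˡ-< i k<)
    ; down = λ k k< → down z (k + i) (ℕ.+-monoˡ-< i k<)
    ; x-#  = λ k k< → x-# z (k + i) (ℕ.+-monoˡ-< i k<)
    ; y-#  = λ k k< → y-# z (k + i) (ℕ.+-monoˡ-< i k<)
    }

  -- Starting at `y 0` drops the two outermost vertices. The walk gets shorter, so the induction on
  -- its length also controls the odd places.
  dual-zigzag : ∀ {s w n x y} → Zigzag s w (suc n) x y → Zigzag (opposite s) w n y (x ∘ suc)
  dual-zigzag {s} z = record
    { up   = λ k k< → Span-opposite s (down z k (ℕ.m≤n⇒m≤1+n k<))
    ; down = λ k k< → Span-opposite s (up z (suc k) (s≤s k<))
    ; x-#  = λ k k< → y-# z k (s≤s k<)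
    ; y-#  = λ k k< → x-# z (suc k) (ℕ.m≤n⇒m≤1+n k<)
    }

  shift-zigzag : ∀ {s w n c x y} → (∀ k → k < n → Head c (y k)) → Zigzag s w n x y →
    Zigzag s (extend s c w) n x (drop 1 ∘ y)
  shift-zigzag {s} h z = record
    { up   = λ k k< → Span-shift s (h k k<) (up z k k<)
    ; down = λ k k< → Span-shift s (h k k<) (down z k k<)
    ; x-#  = x-# z
    ; y-#  = λ k k< → #-tail (subst₂ _#_ (h k (ℕ.<⇒≤ k<)) (h (suc k) k<) (y-# z k k<))
    }

  ZigzagHead : ℕ → Set
  ZigzagHead n = ∀ {s w x y a} → Zigzag s w n x y → Head a (x 0) → Head a (x n) → ∀ k → k ≤ n → Head a (x k)

  -- Between two returns to the letter a at the even places, the first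
  -- and the last edge of the walk traced in the tree ℰ(w) coincide, so
  -- by induction all odd places begin with one letter c; this letter is
  -- then absorbed into w.
  zigzag-step : ∀ n → (∀ {m} → m < n → ZigzagHead m) → ∀ M {s w x y a} → length (y 0) ≤ M →
    Zigzag s w n x y → Head a (x 0) → Head a (x n) → ∀ k → k ≤ n → Head a (x k)
  zigzag-step zero       _ M _ _ h₀ _ zero _ = h₀
  zigzag-step (suc zero) _ M _ _ h₀ _ zero _ = h₀
  zigzag-step (suc zero) _ M _ _ _ h₁ (suc zero) _ = h₁
  zigzag-step (suc zero) _ M _ _ _ h₁ (suc (suc _)) (s≤s ())
  zigzag-step (suc (suc m)) shorter M {s} {w} {x} {y} {a} y₀≤M z h₀ hₙ
    with ℕ.anyUpTo? (λ k → List.≡-dec _≟_ (x (suc k)) (a ∷ drop 1 (x (suc k)))) (suc m)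
  ... | yes (i , i≤m , hᵢ) = λ k k≤n → cases k k≤n (ℕ.≤-total k (suc i))
    where
    n = suc (suc m)

    rest : ℕ
    rest = n ∸ suc i

    rest+ : rest + suc i ≡ n
    rest+ = ℕ.m∸n+n≡m (ℕ.m≤n⇒m≤1+n i≤m)

    cases : ∀ k → k ≤ n → k ≤ suc i ⊎ suc i ≤ k → Head a (x k)
    cases k _ (inj₁ k≤i) =
      shorter (s≤s i≤m) (take-zigzag (ℕ.m≤n⇒m≤1+n i≤m) z) h₀ hᵢ k k≤i
    cases k k≤n (inj₂ i≤k) = subst (Head a ∘ x) (ℕ.m∸n+n≡m i≤k)
      (shorter (s≤s (ℕ.m∸n≤m (suc m) i)) {x = x ∘ (_+ suc i)} {y = y ∘ (_+ suc i)}
        (drop-zigzag rest (suc i) (subst (λ l → Zigzag s w l x y) (sym rest+) z))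
        hᵢ (subst (Head a ∘ x) (sym rest+) hₙ) (k ∸ suc i) (ℕ.∸-monoˡ-≤ (suc i) k≤n))
  ... | no avoid = shifted M y₀≤M
    where
    n = suc (suc m)
    c = hd (y 0)

    w∈S : w ∈ S
    w∈S = Span⇒S s (up z 0 (s≤s z≤n))

    x-Head : ∀ k → k < n → Head (hd (x k)) (x k)
    x-Head k k< = #⇒Headˡ (x-# z k k<)

    y-Head : ∀ k → k < n → Head (hd (y k)) (y k)
    y-Head zero    k< = #⇒Headˡ (y-# z 0 (s≤s (s≤s z≤n)))
    y-Head (suc k) k< = #⇒Headʳ (y-# z k k<)

    Away : Rel (A ⊎ A) 0ℓ
    Away u v = E w u v × u ≢ tag s a × v ≢ tag s a

    x-avoids : ∀ k → k < suc m → tag s (hd (x (suc k))) ≢ tag s a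
    x-avoids k k< eq = avoid (k , k< ,
      subst (λ b → Head b (x (suc k))) (tag-injective s eq) (x-Head (suc k) (s≤s k<)))

    excursion : Star Away (tag (opposite s) c) (tag (opposite s) (hd (y (suc m))))
    excursion = Star.concat (chain (λ k → tag (opposite s) (hd (y k))) (suc m) λ k k< →
      (E-sym w {tag s (hd (x (suc k)))} (Span⇒E s (x-Head (suc k) (s≤s k<)) (y-Head k (ℕ.m≤n⇒m≤1+n k<)) (down z k (ℕ.m≤n⇒m≤1+n k<)))
        , tag-opposite s , x-avoids k k<)
      ◅ (Span⇒E s (x-Head (suc k) (s≤s k<)) (y-Head (suc k) (s≤s k<)) (up z (suc k) (s≤s k<))
        , x-avoids k k< , tag-opposite s)
      ◅ ε)

    y₀≡yₘ : c ≡ hd (y (suc m))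
    y₀≡yₘ = tag-injective (opposite s) (return-edge w w∈S
      (Span⇒E s h₀ (y-Head 0 (s≤s z≤n)) (up z 0 (s≤s z≤n)))
      (Span⇒E s hₙ (y-Head (suc m) ℕ.≤-refl) (down z (suc m) ℕ.≤-refl))
      excursion)

    all-c : ∀ k → k < n → Head c (y k)
    all-c k (s≤s k≤m) = shorter ℕ.≤-refl (dual-zigzag z) (y-Head 0 (s≤s z≤n))
      (subst (λ b → Head b (y (suc m))) (sym y₀≡yₘ) (y-Head (suc m) ℕ.≤-refl)) k k≤m

    -- While `n` stays fixed, `y 0` loses the letter `c` at every shift; its length bound `M` is the
    -- second measure of the induction.
    shifted : ∀ M → length (y 0) ≤ M → ∀ k → k ≤ n → Head a (x k)
    shifted zero    y₀≤M with y 0 | all-c 0 (s≤s z≤n)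
    shifted zero    ()      | _ ∷ _ | _
    shifted (suc M) y₀≤M = zigzag-step n shorter M (ℕ.≤-pred (subst (λ u → length u ≤ suc M) (all-c 0 (s≤s z≤n)) y₀≤M))
      (shift-zigzag all-c z) h₀ hₙ

  zigzag-head : ∀ n → ZigzagHead n
  zigzag-head = <-rec ZigzagHead λ n shorter → zigzag-step n shorter _ ℕ.≤-refl

-- The Stallings automaton of `X`

ʳ++-assoc : {A : Set} (u : List A) {v t : List A} → u ʳ++ (v ++ t) ≡ (u ʳ++ v) ++ t
ʳ++-assoc []      = refl
ʳ++-assoc (a ∷ u) = ʳ++-assoc u

ʳ++-cancelˡ : {A : Set} (u : List A) {v t : List A} → u ʳ++ v ≡ u ʳ++ t → v ≡ t
ʳ++-cancelˡ []      eq = eq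
ʳ++-cancelˡ (a ∷ u) eq = List.∷-injectiveʳ (ʳ++-cancelˡ u eq)

≡ʳ++⇒[] : {A : Set} (t : List A) {w : List A} → w ≡ t ʳ++ w → t ≡ []
≡ʳ++⇒[] []      _  = refl
≡ʳ++⇒[] (a ∷ t) {w} eq = contradiction
  (trans (cong length eq) (trans (List.length-ʳ++ t) (ℕ.+-suc (length t) (length w))))
  (ℕ.m≢1+n+m (length w))

isPrefixOf-++ : {A : Set} (u t : Word A) → u isPrefixOf (u ++ t)
isPrefixOf-++ u t = Prefix.fromView (Pointwise.refl refl Prefix.++ t)

isSuffixOf-++ : {A : Set} (t u : Word A) → u isSuffixOf (t ++ u)
isSuffixOf-++ t u = Suffix.fromView (t Suffix.++ Pointwise.refl refl)

isSuffixOf-ʳ++ : {A : Set} (t u : Word A) → u isSuffixOf (t ʳ++ u)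
isSuffixOf-ʳ++ t u = subst (u isSuffixOf_) (sym (List.ʳ++-defn t)) (isSuffixOf-++ _ u)

_◂_ : {V : Set} → V → (ℕ → V) → ℕ → V
(v ◂ f) zero    = v
(v ◂ f) (suc k) = f k

-- An element `x` of `X` is a petal from `f` to `f ⊙ x`. Since `_⊙_` is applied to whole petals, it
-- need not respect concatenation; `⊙-inv` says that the petals of `x` and `inv x` undo each other.
module Automaton {A : Set} (_≟_ : DecidableEquality A) (θ : A → A) (θ-involutive : ∀ a → θ (θ a) ≡ a)
  (S : Language A) (specular : IsSpecular θ S)
  (X : Language A) (X⊆S : X ⊆ S) (bifix : BifixCode X)
  (X-inv : ∀ {w} → w ∈ X → Presented.inv _≟_ θ θ-involutive w ∈ X)
  (prefixOfX? : ∀ u → Dec (∃[ t ] u ++ t ∈ X))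
  (Φ : Set) (_⊙_ : Φ → Word A → Φ)
  (⊙-inv : ∀ f x → (f ⊙ x) ⊙ Presented.inv _≟_ θ θ-involutive x ≡ f)
  where

  open Specular _≟_ θ θ-involutive S specular
  open Zigzags _≟_ θ θ-involutive S specular
  open BifixCode bifix

  ⊙-cancel : ∀ {f g} x → f ⊙ x ≡ g ⊙ x → f ≡ g
  ⊙-cancel {f} {g} x eq = trans (sym (⊙-inv f x)) (trans (cong (_⊙ inv x) eq) (⊙-inv g x))

  map-θ-≢[] : ∀ {u} → u ≢ [] → map θ u ≢ []
  map-θ-≢[] {[]}    u≢ _  = u≢ refl
  map-θ-≢[] {_ ∷ _} _  ()

  -- An element of X read from the point `start`, cut into two pieces;
  -- the first one is stored reversed.
  record Cut : Set where
    constructor ⟨_,_,_⟩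
    field
      start  : Φ
      before : Word A
      after  : Word A

    word : Word A
    word = before ʳ++ after

    finish : Φ
    finish = start ⊙ word

    leftEnd rightEnd : Φ × Word A
    leftEnd  = start , before
    rightEnd = finish , after

  open Cut

  record Valid (c : Cut) : Set where
    constructor valid
    field
      before≢[] : before c ≢ []
      after≢[]  : after c ≢ []
      word∈X    : word c ∈ X

  open Valid

  -- The same point of the petal, seen from its other end.
  invCut : Cut → Cut
  invCut c = ⟨ finish c , map θ (after c) , map θ (before c) ⟩

  word-invCut : ∀ c → word (invCut c) ≡ inv (word c)
  word-invCut c = sym (inv-ʳ++ (before c) (after c))

  finish-invCut : ∀ c → finish (invCut c) ≡ start c
  finish-invCut c = trans (cong (finish c ⊙_) (word-invCut c)) (⊙-inv (start c) (word c))

  invCut-involutive : ∀ c → invCut (invCut c) ≡ c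
  invCut-involutive c with finish (invCut c) | finish-invCut c
  ... | _ | refl = cong₂ ⟨ start c ,_,_⟩ (map-θ-involutive (before c)) (map-θ-involutive (after c))

  valid-inv : ∀ {c} → Valid c → Valid (invCut c)
  valid-inv {c} (valid b≢ a≢ w∈) =
    valid (map-θ-≢[] a≢) (map-θ-≢[] b≢) (subst (_∈ X) (sym (word-invCut c)) (X-inv w∈))

  data Adjacent (c d : Cut) : Set where
    same-left  : Valid c → Valid d → leftEnd c ≡ leftEnd d → Adjacent c d
    same-right : Valid c → Valid d → rightEnd c ≡ rightEnd d → Adjacent c d

  adjacent-sym : ∀ {c d} → Adjacent c d → Adjacent d c
  adjacent-sym (same-left  vc vd eq) = same-left  vd vc (sym eq)
  adjacent-sym (same-right vc vd eq) = same-right vd vc (sym eq)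

  adjacent-inv : ∀ {c d} → Adjacent c d → Adjacent (invCut c) (invCut d)
  adjacent-inv {c} {d} (same-left vc vd eq) = same-right (valid-inv vc) (valid-inv vd)
    (cong₂ _,_ (trans (finish-invCut c) (trans (cong proj₁ eq) (sym (finish-invCut d)))) (cong (map θ ∘ proj₂) eq))
  adjacent-inv (same-right vc vd eq) = same-left (valid-inv vc) (valid-inv vd)
    (cong (λ (g , v) → g , map θ v) eq)

  Connected : Rel Cut 0ℓ
  Connected = Star Adjacent

  connected-inv : ∀ {c d} → Connected c d → Connected (invCut c) (invCut d)
  connected-inv = Star.gmap invCut adjacent-inv

  data Node : Set where
    base  : Φ → Node
    inner : Cut → Node

  -- The states of the Stallings automaton of X are the classes of nodes.
  infix 4 _≈_

  data _≈_ : Rel Node 0ℓ where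
    base    : ∀ {f g} → f ≡ g → base f ≈ base g
    direct  : ∀ {c d} → Connected c d → inner c ≈ inner d
    flipped : ∀ {c d} → Connected c (invCut d) → inner c ≈ inner d

  ≈-refl : ∀ {M} → M ≈ M
  ≈-refl {base _}  = base refl
  ≈-refl {inner _} = direct ε

  ≈-sym : ∀ {M N} → M ≈ N → N ≈ M
  ≈-sym (base eq)   = base (sym eq)
  ≈-sym (direct p)  = direct (Star.reverse adjacent-sym p)
  ≈-sym (flipped {c} {d} p) = flipped
    (subst (λ z → Connected z (invCut c)) (invCut-involutive d) (connected-inv (Star.reverse adjacent-sym p)))

  ≈-trans : ∀ {M N P} → M ≈ N → N ≈ P → M ≈ P
  ≈-trans (base p)    (base q)    = base (trans p q)
  ≈-trans (direct p)  (direct q)  = direct (p ◅◅ q)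
  ≈-trans (direct p)  (flipped q) = flipped (p ◅◅ q)
  ≈-trans (flipped p) (direct q)  = flipped (p ◅◅ connected-inv q)
  ≈-trans (flipped p) (flipped {d = d} q) =
    direct (p ◅◅ subst (Connected _) (invCut-involutive d) (connected-inv q))

  invNode : Node → Node
  invNode (base f)  = base f
  invNode (inner c) = inner (invCut c)

  invNode-≈ : ∀ M → invNode M ≈ M
  invNode-≈ (base f)  = base refl
  invNode-≈ (inner c) = flipped ε

  data Step : Node → A → Node → Set where
    base-base   : ∀ {f g a} → [ a ] ∈ X → g ≡ f ⊙ [ a ] → Step (base f) a (base g)
    base-inner  : ∀ {f a v} → Valid ⟨ f , [ a ] , v ⟩ → Step (base f) a (inner ⟨ f , [ a ] , v ⟩)
    inner-inner : ∀ {f a u v} → Valid ⟨ f , u , a ∷ v ⟩ → Valid ⟨ f , a ∷ u , v ⟩ →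
                  Step (inner ⟨ f , u , a ∷ v ⟩) a (inner ⟨ f , a ∷ u , v ⟩)
    inner-base  : ∀ {f g a u} → Valid ⟨ f , u , [ a ] ⟩ → g ≡ f ⊙ (u ʳ++ [ a ]) →
                  Step (inner ⟨ f , u , [ a ] ⟩) a (base g)

  step-inv : ∀ {M a N} → Step M a N → Step (invNode N) (θ a) (invNode M)
  step-inv {a = a} (base-base {f} a∈X refl) = base-base (X-inv a∈X) (sym (⊙-inv f [ a ]))
  step-inv (base-inner {f} {a} {v} vc) = inner-base (valid-inv vc) (sym (finish-invCut ⟨ f , [ a ] , v ⟩))
  step-inv (inner-inner vc vd) = inner-inner (valid-inv vd) (valid-inv vc)
  step-inv (inner-base vc refl) = base-inner (valid-inv vc)

  valid-E : ∀ {c} → Valid c → E [] (inj₁ (hd (before c))) (inj₂ (hd (after c)))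
  valid-E {⟨ _ , [] , _ ⟩}         (valid b≢ _ _) = contradiction refl b≢
  valid-E {⟨ _ , _ ∷ _ , [] ⟩}     (valid _ a≢ _) = contradiction refl a≢
  valid-E {⟨ _ , _ ∷ u , _ ∷ v ⟩} (valid _ _ w∈) = J⇒B u [] v (X⊆S w∈)

  -- The tree of ℰ(ε) that contains the edge formed by the two letters at the cut; sharing a left or
  -- a right end preserves it.
  cutSide : Cut → Fin 2
  cutSide c = side (inj₁ (hd (before c)))

  valid-side : ∀ {c} → Valid c → cutSide c ≡ side (inj₂ (hd (after c)))
  valid-side vc = E⇒side≡ (valid-E vc)

  connected-side : ∀ {c d} → Connected c d → cutSide c ≡ cutSide d
  connected-side ε = refl
  connected-side (same-left  vc vd eq ◅ p) = trans (cong (side ∘ inj₁ ∘ hd ∘ proj₂) eq) (connected-side p)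
  connected-side (same-right vc vd eq ◅ p) =
    trans (valid-side vc) (trans (cong (side ∘ inj₂ ∘ hd ∘ proj₂) eq) (trans (sym (valid-side vd)) (connected-side p)))

  -- Inverting a cut continued by `a` puts `θ a` to its left, hence moves it to the tree of
  -- `σ (inj₂ a)`, which is the other one.
  ¬flipped : ∀ {c f u a v} → cutSide c ≡ side (inj₂ a) → ¬ Connected c (invCut ⟨ f , u , a ∷ v ⟩)
  ¬flipped {a = a} eq p = side-σ (inj₂ a) (trans (sym eq) (connected-side p))

  Vertex : Set
  Vertex = Φ × Word A

  XEdge : Rel Vertex 0ℓ
  XEdge (f , u) (g , v) = Valid ⟨ f , u , v ⟩ × f ⊙ (u ʳ++ v) ≡ g

  -- If one rest were a prefix of the other, so would be the two elements of `X`, and these would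
  -- agree since `X` is prefix-free.
  XEdge-right : ∀ {l r r′} → XEdge l r → XEdge l r′ → r ≡ r′ ⊎ proj₂ r # proj₂ r′
  XEdge-right {f , u} {g , v} {g′ , v′} (vc , eq) (vd , eq′) with #-compare v v′
  ... | inj₂ (inj₂ v#v′) = inj₂ v#v′
  ... | inj₁ (t , refl) = inj₁ (cong₂ _,_ (trans (sym eq) (trans (cong (f ⊙_) w≡) eq′)) (ʳ++-cancelˡ u w≡))
    where
    w≡ : u ʳ++ v ≡ u ʳ++ (v ++ t)
    w≡ = prefix-free (word∈X vc) (word∈X vd) (subst ((u ʳ++ v) isPrefixOf_) (sym (ʳ++-assoc u)) (isPrefixOf-++ (u ʳ++ v) t))
  ... | inj₂ (inj₁ (t , refl)) = inj₁ (sym (cong₂ _,_ (trans (sym eq′) (trans (cong (f ⊙_) w≡) eq)) (ʳ++-cancelˡ u w≡)))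
    where
    w≡ : u ʳ++ v′ ≡ u ʳ++ (v′ ++ t)
    w≡ = prefix-free (word∈X vd) (word∈X vc) (subst ((u ʳ++ v′) isPrefixOf_) (sym (ʳ++-assoc u)) (isPrefixOf-++ (u ʳ++ v′) t))

  private
    left-unique : ∀ {f f′ u t v} → u ʳ++ v ∈ X → (u ++ t) ʳ++ v ∈ X → f ⊙ (u ʳ++ v) ≡ f′ ⊙ ((u ++ t) ʳ++ v) →
      (f , u) ≡ (f′ , u ++ t)
    left-unique {f} {f′} {u} {t} {v} x∈ y∈ eq with ≡ʳ++⇒[] t w≡
      where
      w≡ : u ʳ++ v ≡ t ʳ++ (u ʳ++ v)
      w≡ = trans (suffix-free x∈ y∈ (subst ((u ʳ++ v) isSuffixOf_) (sym (List.++-ʳ++ u)) (isSuffixOf-ʳ++ t (u ʳ++ v))))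
        (List.++-ʳ++ u)
    ... | refl = cong₂ _,_ (⊙-cancel (u ʳ++ v) (trans eq (cong (λ z → f′ ⊙ (z ʳ++ v)) (List.++-identityʳ u)))) (sym (List.++-identityʳ u))

  XEdge-left : ∀ {l l′ r} → XEdge l r → XEdge l′ r → l ≡ l′ ⊎ proj₂ l # proj₂ l′
  XEdge-left {f , u} {f′ , u′} {g , v} (vc , eq) (vd , eq′) with #-compare u u′
  ... | inj₂ (inj₂ u#u′)       = inj₂ u#u′
  ... | inj₁ (t , refl)        = inj₁ (left-unique (word∈X vc) (word∈X vd) (trans eq (sym eq′)))
  ... | inj₂ (inj₁ (t , refl)) = inj₁ (sym (left-unique (word∈X vd) (word∈X vc) (trans eq′ (sym eq))))

  -- As a zigzag from right ends to right ends, all of whose edges are cuts.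
  record Walk (n : ℕ) (x y : ℕ → Vertex) : Set where
    field
      up   : ∀ k → k < n → XEdge (y k) (x k)
      down : ∀ k → k < n → XEdge (y k) (x (suc k))
      x-#  : ∀ k → k < n → proj₂ (x k) # proj₂ (x (suc k))
      y-#  : ∀ k → suc k < n → proj₂ (y k) # proj₂ (y (suc k))

  open Walk

  zigzag : ∀ {n x y} → Walk n x y → Zigzag right [] n (proj₂ ∘ x) (proj₂ ∘ y)
  zigzag w = record
    { up   = λ k k< → X⊆S (word∈X (proj₁ (up w k k<)))
    ; down = λ k k< → X⊆S (word∈X (proj₁ (down w k k<)))
    ; x-#  = x-# w
    ; y-#  = y-# w
    }

  tail-walk : ∀ {n x y} → Walk (suc n) x y → Walk n (x ∘ suc) (y ∘ suc)
  tail-walk w = record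
    { up   = λ k k< → up w (suc k) (s≤s k<)
    ; down = λ k k< → down w (suc k) (s≤s k<)
    ; x-#  = λ k k< → x-# w (suc k) (s≤s k<)
    ; y-#  = λ k k< → y-# w (suc k) (s≤s k<)
    }

  cons-walk : ∀ {n x y l r} → XEdge l r → XEdge l (x 0) → proj₂ r # proj₂ (x 0) → (0 < n → proj₂ l # proj₂ (y 0)) →
    Walk n x y → Walk (suc n) (r ◂ x) (l ◂ y)
  cons-walk e e′ r# l# w = record
    { up   = λ { zero _ → e  ; (suc k) (s≤s k<) → up w k k< }
    ; down = λ { zero _ → e′ ; (suc k) (s≤s k<) → down w k k< }
    ; x-#  = λ { zero _ → r# ; (suc k) (s≤s k<) → x-# w k k< }
    ; y-#  = λ { zero (s≤s 0<) → l# 0< ; (suc k) (s≤s k<) → y-# w k k< }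
    }

  cons-zigzag : ∀ {n x y u v} → Span right [] v u → Span right [] (x 0) u → v # x 0 → (0 < n → u # y 0) →
    Zigzag right [] n x y → Zigzag right [] (suc n) (v ◂ x) (u ◂ y)
  cons-zigzag e e′ v# u# z = record
    { up   = λ { zero _ → e  ; (suc k) (s≤s k<) → Zigzag.up z k k< }
    ; down = λ { zero _ → e′ ; (suc k) (s≤s k<) → Zigzag.down z k k< }
    ; x-#  = λ { zero _ → v# ; (suc k) (s≤s k<) → Zigzag.x-# z k k< }
    ; y-#  = λ { zero (s≤s 0<) → u# 0< ; (suc k) (s≤s k<) → Zigzag.y-# z k k< }
    }

  WalkFromTo : Rel Vertex 0ℓ
  WalkFromTo r r′ = ∃[ n ] ∃₂ λ x y → Walk n x y × x 0 ≡ r × x n ≡ r′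

  -- Backtracking is removed at once: if the right ends agree nothing is added, and if the left end
  -- agrees with `y 0` the vertex `x 0` is bypassed.
  prepend : ∀ n {x y l r} → Walk n x y → XEdge l r → XEdge l (x 0) → WalkFromTo r (x n)
  prepend n w e e′ with XEdge-right e e′
  ... | inj₁ refl = n , _ , _ , w , refl , refl
  prepend zero w e e′ | inj₂ r# = 1 , _ , _ , cons-walk e e′ r# (λ ()) w , refl , refl
  prepend (suc n) {y = y} {l} w e e′ | inj₂ r# with XEdge-left e′ (up w 0 (s≤s z≤n))
  ... | inj₁ refl = prepend n (tail-walk w) e (down w 0 (s≤s z≤n))
  ... | inj₂ l#   = suc (suc n) , _ , _ , cons-walk e e′ r# (λ _ → l#) w , refl , refl

  connected⇒walk : ∀ {c d} → Connected c d → WalkFromTo (rightEnd c) (rightEnd d)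
  connected⇒walk {c} ε = 0 , (λ _ → rightEnd c) , (λ _ → rightEnd c) ,
    record { up = λ _ () ; down = λ _ () ; x-# = λ _ () ; y-# = λ _ () } , refl , refl
  connected⇒walk {d = d} (same-right _ _ eq ◅ p) = subst (λ r → WalkFromTo r (rightEnd d)) (sym eq) (connected⇒walk p)
  connected⇒walk {c} (_◅_ {j = c₁} (same-left vc vc₁ refl) p) with connected⇒walk p
  ... | n , x , y , w , x₀≡ , xₙ≡ = subst (WalkFromTo (rightEnd c)) xₙ≡ $
    prepend n {l = leftEnd c} w (vc , refl) (subst (XEdge (leftEnd c)) (sym x₀≡) (vc₁ , refl))

  ∷-#⇒≢[] : ∀ {a u v} → u # v → Head a u → Head a v → drop 1 u ≢ [] × drop 1 v ≢ []
  ∷-#⇒≢[] (differ a≢b) refl refl = contradiction refl a≢b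
  ∷-#⇒≢[] (skip (differ _)) _ _ = (λ ()) , λ ()
  ∷-#⇒≢[] (skip (skip _))   _ _ = (λ ()) , λ ()

  -- Consecutive right ends branch although both begin with `a`, so each of them goes on after `a`.
  -- All cuts of the walk can thus be moved across `a` and remain inner.
  advance : ∀ n {x y f f′ u u′ a v v′} → Walk (suc n) x y → (∀ k → k ≤ suc n → Head a (proj₂ (x k))) →
    x 0 ≡ rightEnd ⟨ f , u , a ∷ v ⟩ → x (suc n) ≡ rightEnd ⟨ f′ , u′ , a ∷ v′ ⟩ →
    u ʳ++ (a ∷ v) ∈ X → u′ ʳ++ (a ∷ v′) ∈ X →
    Valid ⟨ f , a ∷ u , v ⟩ × Valid ⟨ f′ , a ∷ u′ , v′ ⟩ × Connected ⟨ f , a ∷ u , v ⟩ ⟨ f′ , a ∷ u′ , v′ ⟩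
  advance n {x} {y} {f} {f′} {u} {u′} {a} {v} {v′} w h x₀≡ xₙ≡ c∈ d∈ =
    vc , vd , same-right vc (D-valid 0 (s≤s z≤n)) (cong₂ _,_ (trans (sym (cong proj₁ x₀≡)) (sym (D-finish 0 (s≤s z≤n)))) (cong (drop 1 ∘ proj₂) (sym x₀≡)))
      ◅ (Star.concat (chain D n λ k k<n →
          same-left (D-valid k (ℕ.m≤n⇒m≤1+n k<n)) (D′-valid k (ℕ.m≤n⇒m≤1+n k<n)) refl
          ◅ same-right (D′-valid k (ℕ.m≤n⇒m≤1+n k<n)) (D-valid (suc k) (s≤s k<n))
              (cong (_, _) (trans (D′-finish k (ℕ.m≤n⇒m≤1+n k<n)) (sym (D-finish (suc k) (s≤s k<n)))))
          ◅ ε)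
      ◅◅ same-left (D-valid n ℕ.≤-refl) (D′-valid n ℕ.≤-refl) refl
      ◅ same-right (D′-valid n ℕ.≤-refl) vd (cong₂ _,_ (trans (D′-finish n ℕ.≤-refl) (cong proj₁ xₙ≡)) (cong (drop 1 ∘ proj₂) xₙ≡))
      ◅ ε)
    where
    D D′ : ℕ → Cut
    D  k = ⟨ proj₁ (y k) , a ∷ proj₂ (y k) , drop 1 (proj₂ (x k)) ⟩
    D′ k = ⟨ proj₁ (y k) , a ∷ proj₂ (y k) , drop 1 (proj₂ (x (suc k))) ⟩

    nonempty′ : ∀ k → k < suc n → drop 1 (proj₂ (x k)) ≢ [] × drop 1 (proj₂ (x (suc k))) ≢ []
    nonempty′ k k< = ∷-#⇒≢[] (x-# w k k<) (h k (ℕ.<⇒≤ k<)) (h (suc k) k<)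

    D-valid : ∀ k → k < suc n → Valid (D k)
    D-valid k k< = valid (λ ()) (proj₁ (nonempty′ k k<))
      (subst (λ z → proj₂ (y k) ʳ++ z ∈ X) (h k (ℕ.<⇒≤ k<)) (word∈X (proj₁ (up w k k<))))

    D′-valid : ∀ k → k < suc n → Valid (D′ k)
    D′-valid k k< = valid (λ ()) (proj₂ (nonempty′ k k<))
      (subst (λ z → proj₂ (y k) ʳ++ z ∈ X) (h (suc k) k<) (word∈X (proj₁ (down w k k<))))

    D-finish : ∀ k → k < suc n → finish (D k) ≡ proj₁ (x k)
    D-finish k k< = trans (cong (λ z → proj₁ (y k) ⊙ (proj₂ (y k) ʳ++ z)) (sym (h k (ℕ.<⇒≤ k<)))) (proj₂ (up w k k<))

    D′-finish : ∀ k → k < suc n → finish (D′ k) ≡ proj₁ (x (suc k))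
    D′-finish k k< = trans (cong (λ z → proj₁ (y k) ⊙ (proj₂ (y k) ʳ++ z)) (sym (h (suc k) k<))) (proj₂ (down w k k<))

    vc : Valid ⟨ f , a ∷ u , v ⟩
    vc = valid (λ ()) (subst (_≢ []) (cong (drop 1 ∘ proj₂) x₀≡) (proj₁ (nonempty′ 0 (s≤s z≤n)))) c∈

    vd : Valid ⟨ f′ , a ∷ u′ , v′ ⟩
    vd = valid (λ ()) (subst (_≢ []) (cong (drop 1 ∘ proj₂) xₙ≡) (proj₂ (nonempty′ n ℕ.≤-refl))) d∈

  -- With equal right ends both petals may end after `a`; joined by a walk of positive length,
  -- neither does.
  data Aligned (c d : Cut) (a : A) : Set where
    same  : ∀ {f f′ u u′ v} → c ≡ ⟨ f , u , a ∷ v ⟩ → d ≡ ⟨ f′ , u′ , a ∷ v ⟩ → finish c ≡ finish d → Aligned c d a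
    apart : ∀ {f f′ u u′ v v′} → c ≡ ⟨ f , u , a ∷ v ⟩ → d ≡ ⟨ f′ , u′ , a ∷ v′ ⟩ →
            Valid ⟨ f , a ∷ u , v ⟩ → Valid ⟨ f′ , a ∷ u′ , v′ ⟩ →
            Connected ⟨ f , a ∷ u , v ⟩ ⟨ f′ , a ∷ u′ , v′ ⟩ → Aligned c d a

  align : ∀ {f f′ u u′ a v v′} → Valid ⟨ f , u , a ∷ v ⟩ → Valid ⟨ f′ , u′ , a ∷ v′ ⟩ →
    Connected ⟨ f , u , a ∷ v ⟩ ⟨ f′ , u′ , a ∷ v′ ⟩ → Aligned ⟨ f , u , a ∷ v ⟩ ⟨ f′ , u′ , a ∷ v′ ⟩ a
  align {f} {f′} {u} {u′} {a} {v} {v′} vc vd p with connected⇒walk p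
  ... | suc n , x , y , w , x₀≡ , xₙ≡
    with advance n {u = u} {u′} w
      (zigzag-head (suc n) (zigzag w) (subst (Head a ∘ proj₂) (sym x₀≡) refl) (subst (Head a ∘ proj₂) (sym xₙ≡) refl))
      x₀≡ xₙ≡ (word∈X vc) (word∈X vd)
  ...   | vc′ , vd′ , q = apart refl refl vc′ vd′ q
  align {f} {f′} {u} {u′} vc vd p | zero , x , y , w , x₀≡ , xₙ≡ with trans (sym x₀≡) xₙ≡
  ... | eq with cong proj₂ eq
  ...   | refl = same refl refl (cong proj₁ eq)

  -- Determinism: the identifications are already closed under folding. Prefix-freeness settles the
  -- base points, `¬flipped` opposite orientations, and `align` the rest; in particular a petal
  -- never ends where an identified one continues.
  step-cong : ∀ {M N a M′ N′} → M ≈ N → Step M a M′ → Step N a N′ → M′ ≈ N′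
  step-cong (base refl) (base-base _ refl) (base-base _ refl) = base refl
  step-cong (base refl) (base-base a∈X _) (base-inner {v = v} vd) =
    contradiction (List.∷-injectiveʳ (prefix-free a∈X (word∈X vd) (isPrefixOf-++ [ _ ] v))) (after≢[] vd ∘ sym)
  step-cong (base refl) (base-inner {v = v} vc) (base-base a∈X _) =
    contradiction (List.∷-injectiveʳ (prefix-free a∈X (word∈X vc) (isPrefixOf-++ [ _ ] v))) (after≢[] vc ∘ sym)
  step-cong (base refl) (base-inner vc) (base-inner vd) = direct (same-left vc vd refl ◅ ε)
  step-cong (flipped p) (inner-inner vc _) (inner-inner _ _) = contradiction p (¬flipped (valid-side vc))
  step-cong (flipped p) (inner-inner vc _) (inner-base _ _)  = contradiction p (¬flipped (valid-side vc))
  step-cong (flipped p) (inner-base vc _)  (inner-inner _ _) = contradiction p (¬flipped (valid-side vc))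
  step-cong (flipped p) (inner-base vc _)  (inner-base _ _)  = contradiction p (¬flipped (valid-side vc))
  step-cong (direct p) (inner-inner vc vc′) (inner-inner vd vd′) with align vc vd p
  ... | same refl refl eq         = direct (same-right vc′ vd′ (cong (_, _) eq) ◅ ε)
  ... | apart refl refl _ _ q = direct q
  step-cong (direct p) (inner-inner vc vc′) (inner-base vd _) with align vc vd p
  ... | same refl refl eq           = contradiction refl (after≢[] vc′)
  ... | apart refl refl _ vd′ _ = contradiction refl (after≢[] vd′)
  step-cong (direct p) (inner-base vc _) (inner-inner vd vd′) with align vc vd p
  ... | same refl refl eq           = contradiction refl (after≢[] vd′)
  ... | apart refl refl vc′ _ _ = contradiction refl (after≢[] vc′)
  step-cong (direct p) (inner-base vc refl) (inner-base vd refl) with align vc vd p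
  ... | same refl refl eq           = base eq
  ... | apart refl refl vc′ _ _ = contradiction refl (after≢[] vc′)

  -- If p is a left part of an element of X whose class also contains a cut
  -- continued by a, then p a is a left part too as soon as it is read in S:
  -- otherwise p with its continuation in S would extend the walk
  -- between the two cuts, contradicting zigzag-head.
  continue : ∀ {f f′ p p′ s s′ a t} → Valid ⟨ f , p , s ⟩ → Connected ⟨ f , p , s ⟩ ⟨ f′ , p′ , a ∷ s′ ⟩ →
    p ʳ++ (a ∷ t) ∈ S → ∃[ r ] p ʳ++ (a ∷ r) ∈ X
  continue {f} {f′} {p} {p′} {s} {s′} {a} {t} vc q pat∈S with prefixOfX? ((a ∷ p) ʳ++ [])
  ... | yes (r , par∈X) = r , subst (_∈ X) (sym (ʳ++-assoc (a ∷ p))) par∈X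
  ... | no ∄ = ⊥-elim (walk (connected⇒walk q))
    where
    ∄-a : ∀ r → ¬ p ʳ++ (a ∷ r) ∈ X
    ∄-a r par∈X = ∄ (r , subst (_∈ X) (ʳ++-assoc (a ∷ p)) par∈X)

    ∄-Head : ∀ {r} → p ʳ++ r ∈ X → ¬ Head a r
    ∄-Head r∈ h = ∄-a _ (subst (λ z → p ʳ++ z ∈ X) h r∈)

    absurd : ∀ n {x y} → Walk n x y → XEdge (f , p) (x 0) → (0 < n → p # proj₂ (y 0)) → Head a (proj₂ (x n)) → ⊥
    absurd n {x} {y} w e p# h = ∄-Head (word∈X (proj₁ e))
      (zigzag-head (suc n) (cons-zigzag {v = a ∷ t} pat∈S (X⊆S (word∈X (proj₁ e))) a# p# (zigzag w)) refl h 1 (s≤s z≤n))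
      where
      a# : a ∷ t # proj₂ (x 0)
      a# with proj₂ (x 0) | after≢[] (proj₁ e) | ∄-Head (word∈X (proj₁ e))
      ... | []    | r≢[] | _    = contradiction refl r≢[]
      ... | b ∷ r | _    | ¬h = differ λ { refl → ¬h refl }

    walk : WalkFromTo (rightEnd ⟨ f , p , s ⟩) (rightEnd ⟨ f′ , p′ , a ∷ s′ ⟩) → ⊥
    walk (n , x , y , w , x₀≡ , xₙ≡) = start-at n w (subst (XEdge (f , p)) (sym x₀≡) (vc , refl)) (subst (Head a ∘ proj₂) (sym xₙ≡) refl)
      where
      -- The walk may itself turn back to the left end `p`; its first edges are then dropped, so
      -- that the walk extended at `p` does not backtrack.
      start-at : ∀ n {x y} → Walk n x y → XEdge (f , p) (x 0) → Head a (proj₂ (x n)) → ⊥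
      start-at zero    w e h = absurd zero w e (λ ()) h
      start-at (suc n) w e h with XEdge-left e (up w 0 (s≤s z≤n))
      ... | inj₂ p#   = absurd (suc n) w e (λ _ → p#) h
      ... | inj₁ refl = absurd n (tail-walk w) (down w 0 (s≤s z≤n)) (λ 0<n → y-# w 0 (s≤s 0<n)) h

  side-continued : ∀ {f u v a r} → Valid ⟨ f , u , v ⟩ → u ʳ++ (a ∷ r) ∈ S → side (inj₁ (hd u)) ≡ side (inj₂ a)
  side-continued {u = []}             vc _   = contradiction refl (before≢[] vc)
  side-continued {u = b ∷ u} {a = a} {r} _ w∈S = E⇒side≡ {inj₁ b} {inj₂ a} (J⇒B u [] r w∈S)

  -- Words read by the automaton

  module Traces (o : Φ) where

    -- A path from `M` to the base point `o` that may change the representative of the class before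
    -- each letter.
    data Trace : Word A → Node → Set where
      done : ∀ {M} → M ≈ base o → Trace [] M
      step : ∀ {M N N′ a r} → M ≈ N → Step N a N′ → Trace r N′ → Trace (a ∷ r) M

    trace-≈ : ∀ {M N r} → M ≈ N → Trace r N → Trace r M
    trace-≈ p (done q)     = done (≈-trans p q)
    trace-≈ p (step q s t) = step (≈-trans p q) s t

    -- If the next letter is `θ a`, the inverse of the given step is also available, and determinism
    -- brings the trace back to the class of `M`. So traces survive reduction.
    trace-push : ∀ {M N a r} → Step M a N → Trace r N → Trace (push a r) M
    trace-push s t@(done _) = step ≈-refl s t
    trace-push {M} {N} {a} {b ∷ r} s t@(step {N = N₁} q s₁ t₁) with b ≟ θ a
    ... | no _     = step ≈-refl s t
    ... | yes refl = trace-≈ (≈-trans (≈-sym (invNode-≈ M)) (step-cong (≈-trans (invNode-≈ N) q) (step-inv s) s₁)) t₁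

    trace-inner : ∀ {f u r} v → Valid ⟨ f , u , v ⟩ → Trace r (base (f ⊙ (u ʳ++ v))) →
      Trace (foldr push r v) (inner ⟨ f , u , v ⟩)
    trace-inner []          vc t = contradiction refl (after≢[] vc)
    trace-inner (a ∷ [])    vc t = trace-push (inner-base vc refl) t
    trace-inner {f} {u} (a ∷ b ∷ v) vc t = trace-push (inner-inner vc vc′) (trace-inner (b ∷ v) vc′ t)
      where
      vc′ : Valid ⟨ f , a ∷ u , b ∷ v ⟩
      vc′ = valid (λ ()) (λ ()) (word∈X vc)

    trace-∈X : ∀ {f x r} → x ∈ X → Trace r (base (f ⊙ x)) → Trace (foldr push r x) (base f)
    trace-∈X {x = []}         x∈X t = contradiction x∈X nonempty
    trace-∈X {x = a ∷ []}     x∈X t = trace-push (base-base x∈X refl) t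
    trace-∈X {f} {a ∷ b ∷ v} x∈X t = trace-push (base-inner vc) (trace-inner (b ∷ v) vc t)
      where
      vc : Valid ⟨ f , [ a ] , b ∷ v ⟩
      vc = valid (λ ()) (λ ()) x∈X

    -- The base point from which the list leads to `o`, found by undoing its elements from the last
    -- one on.
    origin : List (Word A) → Φ
    origin = foldr (λ x f → f ⊙ inv x) o

    trace-concat : ∀ {xs} → All X xs → Trace (foldr push [] (concat xs)) (base (origin xs))
    trace-concat [] = done (base refl)
    trace-concat {x ∷ xs} (x∈X ∷ xs∈X) =
      subst (λ r → Trace r (base (origin (x ∷ xs)))) (sym (List.foldr-++ push [] x (concat xs)))
        (trace-∈X x∈X (subst (Trace _ ∘ base) (sym origin-⊙) (trace-concat xs∈X)))
      where
      origin-⊙ : (origin xs ⊙ inv x) ⊙ x ≡ origin xs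
      origin-⊙ = trans (cong ((origin xs ⊙ inv x) ⊙_) (sym (inv-involutive x))) (⊙-inv (origin xs) (inv x))

    trivial⇒origin : ∀ {xs} → All X xs → foldr push [] (concat xs) ≡ [] → origin xs ≡ o
    trivial⇒origin {xs} xs∈X eq with foldr push [] (concat xs) | eq | trace-concat xs∈X
    ... | .[] | refl | done (base p) = p

    -- A trace only guarantees that some identified cut is continued by the next letter. Membership
    -- in `S` lets `continue` supply an element of `X` that extends the part `u` actually read, and
    -- the cut is replaced by one of this element.
    trace-base⇒⋆ : ∀ {r f} → Trace r (base f) → r ∈ S → r ∈ X ⋆
    trace-inner⇒⋆ : ∀ {r f u v} → Valid ⟨ f , u , v ⟩ → Trace r (inner ⟨ f , u , v ⟩) → u ʳ++ r ∈ S → u ʳ++ r ∈ X ⋆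

    trace-base⇒⋆ (done _) _ = [] , [] , refl
    trace-base⇒⋆ {a ∷ _} (step (base _) (base-base a∈X _) t) w∈S with trace-base⇒⋆ t (suffix-S [ a ] w∈S)
    ... | xs , xs∈X , refl = [ a ] ∷ xs , a∈X ∷ xs∈X , refl
    trace-base⇒⋆ (step (base _) (base-inner vc) t) w∈S = trace-inner⇒⋆ vc t w∈S

    private
      trace-continue : ∀ {a r f u s N N′} → Valid ⟨ f , u , s ⟩ →
        ∀ t → u ʳ++ (a ∷ t) ∈ X → inner ⟨ f , u , s ⟩ ≈ N → Step N a N′ → Trace r N′ →
        u ʳ++ (a ∷ r) ∈ S → u ʳ++ (a ∷ r) ∈ X ⋆
      trace-continue {a} {r} {f} {u} vc [] x∈X p s tr w∈S
        with trace-base⇒⋆ (trace-≈ (step-cong (≈-trans (direct (same-left vc₁ vc refl ◅ ε)) p) (inner-base vc₁ refl) s) tr)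
               (ʳ++-suffix-S (a ∷ u) w∈S)
        where
        vc₁ : Valid ⟨ f , u , [ a ] ⟩
        vc₁ = valid (before≢[] vc) (λ ()) x∈X
      ... | xs , xs∈X , refl = (u ʳ++ [ a ]) ∷ xs , x∈X ∷ xs∈X , sym (ʳ++-assoc u)
      trace-continue {a} {r} {f} {u} vc (b ∷ t) x∈X p s tr w∈S =
        trace-inner⇒⋆ vc₂ (trace-≈ (step-cong (≈-trans (direct (same-left vc₁ vc refl ◅ ε)) p) (inner-inner vc₁ vc₂) s) tr) w∈S
        where
        vc₁ : Valid ⟨ f , u , a ∷ b ∷ t ⟩
        vc₁ = valid (before≢[] vc) (λ ()) x∈X

        vc₂ : Valid ⟨ f , a ∷ u , b ∷ t ⟩
        vc₂ = valid (λ ()) (λ ()) x∈X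

    trace-inner⇒⋆ vc (done ()) _
    trace-inner⇒⋆ {a ∷ r} {f} {u} {v} vc (step p@(direct q) s@(inner-inner _ _) t) w∈S with continue vc q w∈S
    ... | r′ , x∈X = trace-continue vc r′ x∈X p s t w∈S
    trace-inner⇒⋆ {a ∷ r} {f} {u} {v} vc (step p@(direct q) s@(inner-base _ _) t) w∈S with continue vc q w∈S
    ... | r′ , x∈X = trace-continue vc r′ x∈X p s t w∈S
    trace-inner⇒⋆ {a ∷ r} {f} {u} {v} vc (step (flipped q) (inner-inner _ _) t) w∈S = contradiction q (¬flipped (side-continued vc w∈S))
    trace-inner⇒⋆ {a ∷ r} {f} {u} {v} vc (step (flipped q) (inner-base _ _) t)  w∈S = contradiction q (¬flipped (side-continued vc w∈S))

    saturated : ∀ {w xs} → w ∈ S → All X xs → foldr push [] (concat xs) ≡ w → w ∈ X ⋆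
    saturated w∈S xs∈X refl = trace-base⇒⋆ (trace-concat xs∈X) w∈S

-- Saturation and freeness

module Basis {A : Set} (_≟_ : DecidableEquality A) (θ : A → A) (θ-involutive : ∀ a → θ (θ a) ≡ a)
  (S : Language A) (specular : IsSpecular θ S)
  (X : Language A) (X⊆S : X ⊆ S) (bifix : BifixCode X)
  (X-inv : ∀ {w} → w ∈ X → Presented.inv _≟_ θ θ-involutive w ∈ X)
  (prefixOfX? : ∀ u → Dec (∃[ t ] u ++ t ∈ X))
  where

  open Specular _≟_ θ θ-involutive S specular

  Generated : Pred (Expr A) 0ℓ
  Generated = GeneratedMonoid (Gθ θ) (⟪_⟫ θ X)

  _≃_ : Word A → Expr A → Set
  x ≃ g = _~_ θ ⟦ x ⟧ g

  factorWords : ∀ {gs} → All (⟪_⟫ θ X) gs → ∃[ xs ] All X xs × Pointwise _≃_ xs gs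
  factorWords [] = [] , [] , []
  factorWords ((x , x∈X , x~) ∷ ps) with factorWords ps
  ... | xs , xs∈X , xs≃ = x ∷ xs , x∈X ∷ xs∈X , x~ ∷ xs≃

  ⟦concat⟧ : ∀ {xs gs} → Pointwise _≃_ xs gs → concat xs ≃ product (Gθ θ) gs
  ⟦concat⟧ [] = ~-refl
  ⟦concat⟧ {x ∷ xs} (x~ ∷ xs≃) = ~-trans (⟦⟧-++ x (concat xs)) (·-cong x~ (⟦concat⟧ xs≃))

  S∩Generated⊆⋆ : ∀ {w} → w ∈ S → ⟦ w ⟧ ∈ Generated → w ∈ X ⋆
  S∩Generated⊆⋆ {w} w∈S (gs , gs∈ , gs~) with factorWords gs∈
  ... | xs , xs∈X , xs≃ =
    Automaton.Traces.saturated _≟_ θ θ-involutive S specular X X⊆S bifix X-inv prefixOfX? ⊤ (λ _ _ → tt) (λ _ _ → refl) tt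
      w∈S xs∈X (⟦⟧-~⇒≡ {concat xs} (reduced⇒noCancellation (S-reduced w∈S)) (~-trans (⟦concat⟧ xs≃) gs~))

  module Words = Stack (List.≡-dec _≟_) inv inv-involutive

  -- Formal reduced products. Arbitrary words are allowed as entries, so that `_⊙_` is defined
  -- everywhere.
  Position : Set
  Position = ∃ Words.NoCancellation

  position-≡ : ∀ {p q : Position} → proj₁ p ≡ proj₁ q → p ≡ q
  position-≡ {_ , nc} {_ , nc′} refl = cong (_ ,_) (Linked.irrelevant (λ _ _ → refl) nc nc′)

  _⊙_ : Position → Word A → Position
  (f , nc) ⊙ x = Words.push (inv x) f , Words.push-noCancellation (inv x) nc

  ⊙-inv : ∀ p x → (p ⊙ x) ⊙ inv x ≡ p
  ⊙-inv (f , nc) x = position-≡ (Words.push-ι-push (inv x) nc)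

  open Automaton _≟_ θ θ-involutive S specular X X⊆S bifix X-inv prefixOfX? Position _⊙_ ⊙-inv using (module Traces)
  open Traces ([] , [])

  origin-word : ∀ xs → proj₁ (origin xs) ≡ foldr Words.push [] xs
  origin-word []       = refl
  origin-word (x ∷ xs) = cong₂ Words.push (inv-involutive x) (origin-word xs)

  -- A trivial product is traced without moving, so its origin is the empty position; but the origin
  -- of a list without cancellation is the list itself.
  concat-nontrivial : ∀ {x xs} → All X (x ∷ xs) → Words.NoCancellation (x ∷ xs) → foldr push [] (concat (x ∷ xs)) ≢ []
  concat-nontrivial {x} {xs} xs∈X nc eq
    with trans (sym (Words.foldr-push-id nc)) (trans (sym (origin-word (x ∷ xs))) (cong proj₁ (trivial⇒origin xs∈X eq)))
  ... | ()

  noCancellation-words : ∀ {xs gs} → Pointwise _≃_ xs gs → Linked (λ g h → ¬ _~_ θ (g · h) one) gs → Words.NoCancellation xs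
  noCancellation-words [] _ = []
  noCancellation-words (_ ∷ []) _ = [-]
  noCancellation-words {x ∷ _} (x~ ∷ y~ ∷ ps) (¬xy ∷ l) =
    (λ { refl → ¬xy (~-trans (·-cong (~-sym x~) (~-trans (~-sym y~) (⟦⟧-inv x))) (inverseʳ _)) })
      ∷ noCancellation-words (y~ ∷ ps) l

  free : ∀ g gs → All (⟪_⟫ θ X) (g ∷ gs) → Linked (λ x y → ¬ _~_ θ (x · y) one) (g ∷ gs) → ¬ _~_ θ (product (Gθ θ) (g ∷ gs)) one
  free g gs gs∈ l eq with factorWords gs∈
  ... | x ∷ xs , xs∈X , xs≃ = concat-nontrivial xs∈X (noCancellation-words xs≃ l)
    (⟦⟧-~⇒≡ {concat (x ∷ xs)} [] (~-trans (⟦concat⟧ xs≃) eq))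

-- Sets of group elements carried along `S`

module Coverage {A : Set} (_≟_ : DecidableEquality A) (θ : A → A) (θ-involutive : ∀ a → θ (θ a) ≡ a)
  (S : Language A) (specular : IsSpecular θ S) where

  open Specular _≟_ θ θ-involutive S specular
  open import Algebra.Properties.Group (Gθ θ) using (⁻¹-anti-homo-∙; inverseʳ-unique; //-rightDividesˡ; //-rightDividesʳ; \\-leftDividesˡ)

  -- K w is a set of group elements attached to the right end of w ∈ S
  -- and carried along when w slides over S or is read backwards.
  record Equivariant (N : ℕ) (K : Word A → Pred (Expr A) 0ℓ) : Set where
    field
      resp  : ∀ w {g h} → _~_ θ g h → K w g → K w h
      slide : ∀ a w b → length w ≡ N → (a , b) ∈ B S w → ∀ g → K (a ∷ w) g ⇔ K (w ++ [ b ]) (g · gen b)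
      turn  : ∀ w → w ∈ S → length w ≡ suc N → ∀ g → K w g → K (inv w) (g · ⟦ w ⟧ ⁻)

    -- With the shift by `gen b` at right vertices, `slide` becomes constancy along the edges of
    -- ℰ(w), and connectedness can be applied.
    AtVertex : Word A → A ⊎ A → Pred (Expr A) 0ℓ
    AtVertex w (inj₁ a) g = K (a ∷ w) g
    AtVertex w (inj₂ b) g = K (w ++ [ b ]) (g · gen b)

    edge-⇔ : ∀ {w} → length w ≡ N → ∀ u v → E w u v → ∀ g → AtVertex w u g ⇔ AtVertex w v g
    edge-⇔ {w} len (inj₁ a) (inj₂ b) e g = slide a w b len e g
    edge-⇔ {w} len (inj₂ b) (inj₁ a) e g = ⇔.sym (slide a w b len e g)

    path-⇔ : ∀ {w} → length w ≡ N → ∀ {u v} → Star (E w) u v → ∀ g → AtVertex w u g ⇔ AtVertex w v g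
    path-⇔ len ε g = ⇔.refl
    path-⇔ len (_◅_ {i = u} {j = v} e p) g = ⇔.trans (edge-⇔ len u v e g) (path-⇔ len p g)

    vertices-⇔ : ∀ {w} → w ∈ S → w ≢ [] → length w ≡ N → ∀ u v → Graph.Vertex (ℰ S-factorial w) u → Graph.Vertex (ℰ S-factorial w) v →
      ∀ g → AtVertex w u g ⇔ AtVertex w v g
    vertices-⇔ w∈S w≢[] len u v u∈ v∈ = path-⇔ len (IsTree.connected (tree _ w∈S w≢[]) u v u∈ v∈)

  module _ {K : Word A → Pred (Expr A) 0ℓ} (equivariant : Equivariant 0 K) where
    open Equivariant equivariant

    σ-⇔ : ∀ v g → AtVertex [] v g ⇔ AtVertex [] (σ v) g
    σ-⇔ (inj₁ a) g = mk⇔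
      (λ k → resp [ θ a ] (·-cong ~-refl turned) (turn [ a ] (letters a) refl g k))
      (λ k → subst (λ b → K [ b ] g) (θ-involutive a)
        (resp [ θ (θ a) ] cancelled (turn [ θ a ] (letters (θ a)) refl (g · gen (θ a)) k)))
      where
      turned : _~_ θ ((gen a · one) ⁻) (gen (θ a))
      turned = ~-trans (⁻-cong (identityʳ (gen a))) (~-sym (inverseʳ-unique (gen a) (gen (θ a)) (relation a)))

      cancelled : _~_ θ (g · gen (θ a) · (gen (θ a) · one) ⁻) g
      cancelled = ~-trans (·-cong ~-refl (⁻-cong (identityʳ (gen (θ a))))) (//-rightDividesʳ (gen (θ a)) g)
    σ-⇔ (inj₂ b) g = ⇔.sym
      (subst (λ c → AtVertex [] (inj₁ (θ b)) g ⇔ AtVertex [] (inj₂ c) g) (θ-involutive b) (σ-⇔ (inj₁ (θ b)) g))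

    -- If `u` and `v` lie in different trees, `σ v` lies in the tree of `u`, there being only two;
    -- `turn` on single letters leads from `σ v` to `v`.
    all-⇔ : ∀ u v g → AtVertex [] u g ⇔ AtVertex [] v g
    all-⇔ u v g with side u Fin.≟ side v
    ... | yes eq = path-⇔ refl (side≡⇒connected u v eq) g
    ... | no  ne = ⇔.trans (path-⇔ refl (side≡⇒connected u (σ v) (other _ _ _ ne (side-σ v))) g) (⇔.sym (σ-⇔ v g))
      where
      other : ∀ (i j k : Fin 2) → i ≢ j → j ≢ k → i ≡ k
      other zero       zero       _          i≢j _ = contradiction refl i≢j
      other zero       (suc zero) zero       _   _ = refl
      other zero       (suc zero) (suc zero) _ j≢k = contradiction refl j≢k
      other (suc zero) zero       zero       _ j≢k = contradiction refl j≢k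
      other (suc zero) zero       (suc zero) _   _ = refl
      other (suc zero) (suc zero) _          i≢j _ = contradiction refl i≢j

    -- Going from the left vertex `a` to the right vertex `c` multiplies by `c`; going back through
    -- the left vertex `c` costs nothing. This treats the generators, hence the whole group.
    invariant : ∀ a k g → K [ a ] g ⇔ K [ a ] (g · k)
    invariant a (gen c) g = ⇔.trans (all-⇔ (inj₁ a) (inj₂ c) g) (all-⇔ (inj₁ c) (inj₁ a) (g · gen c))
    invariant a one g = mk⇔ (resp [ a ] (~-sym (identityʳ g))) (resp [ a ] (identityʳ g))
    invariant a (k · l) g = ⇔.trans (⇔.trans (invariant a k g) (invariant a l (g · k)))
      (mk⇔ (resp [ a ] (·-assoc g k l)) (resp [ a ] (~-sym (·-assoc g k l))))
    invariant a (k ⁻) g = ⇔.trans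
      (mk⇔ (resp [ a ] (~-sym (//-rightDividesˡ k g))) (resp [ a ] (//-rightDividesˡ k g)))
      (⇔.sym (invariant a k (g · k ⁻)))

  nonempty : ∀ {n} {w : Word A} → length w ≡ suc n → w ≢ []
  nonempty () refl

  -- For longer words, the trees ℰ(w) allow to forget the first letter.
  all-or-nothing : ∀ N {K} → Equivariant N K → ∀ w → w ∈ S → length w ≡ suc N → ∀ g h → K w g → K w h
  all-or-nothing zero equivariant (a ∷ []) _ _ g h k =
    Equivariant.resp equivariant [ a ] (\\-leftDividesˡ g h) (Equivalence.to (invariant equivariant a (g ⁻ · h) g) k)
  all-or-nothing (suc N) {K} equivariant (a ∷ w) aw∈S len g h k
    with all-or-nothing N shorter w w∈S (ℕ.suc-injective len) g h (a , aw∈S , k)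
    where
    open Equivariant equivariant

    w∈S = suffix-S [ a ] aw∈S

    leftExtension : ∀ w → w ∈ S → ∃[ a ] a ∷ w ∈ S
    leftExtension w w∈S with extendable w w∈S
    ... | (a , b) , e = a , prefix-S (a ∷ w) [ b ] e

    -- The choice of the letter is immaterial: for the nonempty words in question, all left vertices
    -- of the tree ℰ(w) carry the same set.
    K′ : Word A → Pred (Expr A) 0ℓ
    K′ w g = ∃[ a ] a ∷ w ∈ S × K (a ∷ w) g

    length-∷ʳ : ∀ (w : Word A) b → length (w ++ [ b ]) ≡ suc (length w)
    length-∷ʳ w b = trans (List.length-++ w) (ℕ.+-comm (length w) 1)

    shorter : Equivariant N K′
    shorter = record
      { resp  = λ { w p (a , aw∈S , k) → a , aw∈S , resp (a ∷ w) p k }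
      ; slide = λ a w b len e g → mk⇔
          (λ { (c , caw∈S , k) → a , e , Equivalence.to (vertices-⇔ (prefix-S (a ∷ w) [ b ] e) (λ ()) (cong suc len) (inj₁ c) (inj₂ b) caw∈S e g) k })
          (λ { (c , cwb∈S , k) → let c′ , c′aw∈S = leftExtension (a ∷ w) (prefix-S (a ∷ w) [ b ] e) in
            c′ , c′aw∈S ,
            Equivalence.from (vertices-⇔ (prefix-S (a ∷ w) [ b ] e) (λ ()) (cong suc len) (inj₁ c′) (inj₂ b) c′aw∈S e g)
              (Equivalence.to
                (vertices-⇔ (suffix-S [ a ] e) (nonempty (length-∷ʳ w b)) (trans (length-∷ʳ w b) (cong suc len))
                  (inj₁ c) (inj₁ a) cwb∈S e (g · gen b)) k) })
      ; turn  = λ { w w∈S len g (a , aw∈S , k) → turn′ w w∈S len g a aw∈S k (leftExtension (inv w) (S-inv w∈S)) }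
      }
      where
      inv-∷ : ∀ a w → inv (a ∷ w) ≡ inv w ++ [ θ a ]
      inv-∷ a w = inv-++ [ a ] w

      -- Inversion turns the left extension `a` into the right extension `θ a` of `inv w`; the tree
      -- of `inv w` leads from there to a left extension `c`.
      turn′ : ∀ w → w ∈ S → length w ≡ suc N → ∀ g a → a ∷ w ∈ S → K (a ∷ w) g → (∃[ c ] c ∷ inv w ∈ S) → K′ (inv w) (g · ⟦ w ⟧ ⁻)
      turn′ w w∈S len g a aw∈S k (c , cw∈S) = c , cw∈S ,
        Equivalence.from
          (vertices-⇔ (S-inv w∈S) (nonempty (trans (length-inv w) len)) (trans (length-inv w) len) (inj₁ c) (inj₂ (θ a)) cw∈S
            (subst (_∈ S) (inv-∷ a w) (S-inv aw∈S)) (g · ⟦ w ⟧ ⁻))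
          (resp (inv w ++ [ θ a ]) moved (subst (λ u → K u (g · ⟦ a ∷ w ⟧ ⁻)) (inv-∷ a w) (turn (a ∷ w) aw∈S (cong suc len) g k)))
        where
        moved : _~_ θ (g · (gen a · ⟦ w ⟧) ⁻) (g · ⟦ w ⟧ ⁻ · gen (θ a))
        moved = ~-trans (·-cong ~-refl (~-trans (⁻¹-anti-homo-∙ (gen a) ⟦ w ⟧)
          (·-cong ~-refl (~-sym (inverseʳ-unique (gen a) (gen (θ a)) (relation a))))))
          (~-sym (·-assoc g (⟦ w ⟧ ⁻) (gen (θ a))))
  ... | c , cw∈S , k′ = Equivalence.to
    (Equivariant.vertices-⇔ equivariant (suffix-S [ a ] aw∈S) (nonempty (ℕ.suc-injective len)) (ℕ.suc-injective len) (inj₁ c) (inj₁ a) cw∈S aw∈S h) k′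

-- Parses and cosets

++-compare : {A : Set} (u u′ : List A) {p p′ : List A} → u ++ p ≡ u′ ++ p′ →
  (∃[ t ] u′ ≡ u ++ t × p ≡ t ++ p′) ⊎ (∃[ t ] u ≡ u′ ++ t × p′ ≡ t ++ p)
++-compare []      u′ eq = inj₁ (u′ , refl , eq)
++-compare (a ∷ u) [] eq = inj₂ (a ∷ u , refl , sym eq)
++-compare (a ∷ u) (b ∷ u′) eq with List.∷-injective eq
... | refl , eq′ with ++-compare u u′ eq′
...   | inj₁ (t , p , q) = inj₁ (t , cong (a ∷_) p , q)
...   | inj₂ (t , p , q) = inj₂ (t , cong (a ∷_) p , q)

prefix⇒++ : {A : Set} {u w : Word A} → u isPrefixOf w → ∃[ t ] w ≡ u ++ t
prefix⇒++ p with Prefix.toView p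
... | eq Prefix.++ t with Pointwise.Pointwise-≡⇒≡ eq
...   | refl = t , refl

suffix⇒++ : {A : Set} {u w : Word A} → u isSuffixOf w → ∃[ t ] w ≡ t ++ u
suffix⇒++ p with Suffix.toView p
... | t Suffix.++ eq with Pointwise.Pointwise-≡⇒≡ eq
...   | refl = t , refl

take-length-∸ : {A : Set} (u p : List A) → take (length (u ++ p) ∸ length p) (u ++ p) ≡ u
take-length-∸ u p = trans (cong (λ n → take n (u ++ p)) (trans (cong (_∸ length p) (List.length-++ u)) (ℕ.m+n∸n≡m (length u) (length p)))) (go u)
  where
  go : ∀ u → take (length u) (u ++ p) ≡ u
  go []      = refl
  go (a ∷ u) = cong (a ∷_) (go u)

lookup-injective : {A : Set} {xs : List A} → Unique xs → ∀ {i j} → lookup xs i ≡ lookup xs j → i ≡ j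
lookup-injective (_ ∷ _)  {zero}  {zero}  _  = refl
lookup-injective (x∉ ∷ _) {zero}  {suc j} eq = contradiction eq (All.lookup x∉ (Mem.∈-lookup j))
lookup-injective (x∉ ∷ _) {suc i} {zero}  eq = contradiction (sym eq) (All.lookup x∉ (Mem.∈-lookup i))
lookup-injective (_ ∷ u)  {suc i} {suc j} eq = cong suc (lookup-injective u eq)

⋆-++ : {A : Set} {X : Language A} {u v : Word A} → u ∈ X ⋆ → v ∈ X ⋆ → u ++ v ∈ X ⋆
⋆-++ (xs , xs∈X , refl) (ys , ys∈X , refl) = xs ++ ys , All.++⁺ xs∈X ys∈X , sym (List.concat-++ xs ys)

module _ (G : Group 0ℓ 0ℓ) (H : Subgroup G) where

  coset-injective : ∀ {d} (I : HasIndex G H d) → ∀ {g h} → Inverse.to I g ≡ Inverse.to I h → Setoid._≈_ (Cosets G H) g h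
  coset-injective I {g} {h} = Injection.injective (Inverse⇒Injection I) {g} {h}

  index-≤ : ∀ {d e} → HasIndex G H d → HasIndex G H e → d ≤ e
  index-≤ I J = Fin.injective⇒≤ {f = Inverse.to J ∘ Inverse.from I} λ eq →
    trans (sym (Inverse.strictlyInverseˡ I _))
      (trans (Inverse.to-cong I (coset-injective J eq)) (Inverse.strictlyInverseˡ I _))

module Degree {A : Set} (_≟_ : DecidableEquality A) (θ : A → A) (θ-involutive : ∀ a → θ (θ a) ≡ a)
  (S : Language A) (specular : IsSpecular θ S)
  (X : Language A) (X⊆S : X ⊆ S) (finite : IsFinite X) (bifix : BifixCode X)
  (X-inv : ∀ {w} → w ∈ X → Presented.inv _≟_ θ θ-involutive w ∈ X)
  where

  open Specular _≟_ θ θ-involutive S specular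
  open Coverage _≟_ θ θ-involutive S specular using (Equivariant; all-or-nothing)
  open BifixCode bifix
  open import Algebra.Properties.Group (Gθ θ) using (⁻¹-anti-homo-∙; ⁻¹-anti-homo-//; ⁻¹-involutive; ε⁻¹≈ε; //-rightDividesˡ; //-rightDividesʳ)
  open import Relation.Binary.Reasoning.Setoid (Group.setoid (Gθ θ))

  elements : List (Word A)
  elements = proj₁ finite

  NoPrefix NoSuffix : Word A → Set
  NoPrefix p = ∀ {x} → x isPrefixOf p → x ∉ X
  NoSuffix q = ∀ {x} → x isSuffixOf q → x ∉ X

  prefixIn? : ∀ w → (∃₂ λ x t → x ∈ X × w ≡ x ++ t) ⊎ NoPrefix w
  prefixIn? w with Any.any? (λ x → PrefixProperties.prefix? _≟_ x w) elements
  ... | no ∄ = inj₂ λ {x} x≤w x∈X → ∄ (lose (Equivalence.to (proj₂ finite x) x∈X) x≤w)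
  ... | yes ∃x with find ∃x
  ...   | x , x∈ , x≤w with prefix⇒++ x≤w
  ...     | t , eq = inj₁ (x , t , Equivalence.from (proj₂ finite x) x∈ , eq)

  prefixOfX? : ∀ u → Dec (∃[ t ] u ++ t ∈ X)
  prefixOfX? u with Any.any? (λ x → PrefixProperties.prefix? _≟_ u x) elements
  ... | no ∄ = no λ (t , ut∈X) → ∄ (lose (Equivalence.to (proj₂ finite (u ++ t)) ut∈X) (isPrefixOf-++ u t))
  ... | yes ∃x with find ∃x
  ...   | x , x∈ , u≤x with prefix⇒++ u≤x
  ...     | t , eq = yes (t , subst (_∈ X) eq (Equivalence.from (proj₂ finite x) x∈))

  private
    bound : (xs : List (Word A)) → ∃[ n ] All (λ x → length x ≤ n) xs
    bound [] = 0 , []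
    bound (x ∷ xs) with bound xs
    ... | n , ps = length x + n , ℕ.m≤m+n (length x) n ∷ All.map (λ p → ℕ.≤-trans p (ℕ.m≤n+m n (length x))) ps

  -- Strictly above all lengths in `X`, so that no element of `X` extends a word of length `ℓ`.
  ℓ : ℕ
  ℓ = suc (proj₁ (bound elements))

  length<ℓ : ∀ {x} → x ∈ X → length x < ℓ
  length<ℓ {x} x∈X = s≤s (All.lookup (proj₂ (bound elements)) (Equivalence.to (proj₂ finite x) x∈X))

  open Basis _≟_ θ θ-involutive S specular X X⊆S bifix X-inv prefixOfX?

  RightComplete : Set
  RightComplete = ∀ u → u ∈ S → ℓ ≤ length u → ∃₂ λ x t → x ∈ X × u ≡ x ++ t

  noPrefix-[] : NoPrefix []
  noPrefix-[] [] = nonempty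

  noPrefix-inv : ∀ {q} → NoSuffix q → NoPrefix (inv q)
  noPrefix-inv {q} ns {x} x≤ x∈X with prefix⇒++ x≤
  ... | t , eq = ns (subst (inv x isSuffixOf_) (trans (sym (inv-++ x t)) (trans (cong inv (sym eq)) (inv-involutive q)))
    (isSuffixOf-++ (inv t) (inv x))) (X-inv x∈X)

  noSuffix-inv : ∀ {p} → NoPrefix p → NoSuffix (inv p)
  noSuffix-inv {p} np {x} x≤ x∈X with suffix⇒++ x≤
  ... | t , eq = np (subst (inv x isPrefixOf_) (trans (sym (inv-++ t x)) (trans (cong inv (sym eq)) (inv-involutive p)))
    (isPrefixOf-++ (inv x) (inv t))) (X-inv x∈X)

  ∈⇒⋆ : ∀ {x} → x ∈ X → x ∈ X ⋆
  ∈⇒⋆ {x} x∈X = [ x ] , x∈X ∷ [] , List.++-identityʳ x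

  ⋆-inv : ∀ {w} → w ∈ X ⋆ → inv w ∈ X ⋆
  ⋆-inv ([] , [] , refl) = [] , [] , refl
  ⋆-inv (x ∷ xs , x∈X ∷ xs∈X , refl) = subst (_∈ X ⋆) (sym (inv-++ x (concat xs)))
    (⋆-++ (⋆-inv (xs , xs∈X , refl)) (∈⇒⋆ (X-inv x∈X)))

  ⋆⇒prefix : ∀ {w} → w ∈ X ⋆ → w ≡ [] ⊎ (∃₂ λ x t → x ∈ X × w ≡ x ++ t)
  ⋆⇒prefix ([] , _ , refl) = inj₁ refl
  ⋆⇒prefix (x ∷ xs , x∈X ∷ _ , refl) = inj₂ (x , concat xs , x∈X , refl)

  factorˡ : ∀ n w → length w ≤ n → ∃₂ λ x p → w ≡ x ++ p × x ∈ X ⋆ × NoPrefix p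
  factorˡ zero [] _ = [] , [] , refl , ([] , [] , refl) , noPrefix-[]
  factorˡ (suc n) w len with prefixIn? w
  ... | inj₂ np = [] , w , refl , ([] , [] , refl) , np
  ... | inj₁ ([] , t , x∈X , eq) = contradiction x∈X nonempty
  ... | inj₁ (a ∷ x , t , x∈X , refl) with factorˡ n t (ℕ.≤-trans (List.length-++-≤ʳ t {x}) (ℕ.≤-pred len))
  ...   | y , p , refl , y∈X⋆ , np = (a ∷ x) ++ y , p , sym (List.++-assoc (a ∷ x) y p) , ⋆-++ (∈⇒⋆ x∈X) y∈X⋆ , np

  factorʳ : ∀ w → ∃₂ λ q x → w ≡ q ++ x × NoSuffix q × x ∈ X ⋆
  factorʳ w with factorˡ _ (inv w) ℕ.≤-refl
  ... | x , p , eq , x∈X⋆ , np = inv p , inv x , trans (sym (inv-involutive w)) (trans (cong inv eq) (inv-++ x p)) , noSuffix-inv np , ⋆-inv x∈X⋆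

  factorˡ-unique : ∀ xs ys {p p′} → All X xs → All X ys → NoPrefix p → NoPrefix p′ →
    concat xs ++ p ≡ concat ys ++ p′ → concat xs ≡ concat ys
  factorˡ-unique [] [] _ _ _ _ _ = refl
  factorˡ-unique [] (y ∷ ys) {p′ = p′} _ (y∈X ∷ _) np _ refl =
    contradiction y∈X (np (subst (y isPrefixOf_) (sym (List.++-assoc y (concat ys) p′)) (isPrefixOf-++ y _)))
  factorˡ-unique (x ∷ xs) [] {p} (x∈X ∷ _) _ _ np′ refl =
    contradiction x∈X (np′ (subst (x isPrefixOf_) (sym (List.++-assoc x (concat xs) p)) (isPrefixOf-++ x _)))
  factorˡ-unique (x ∷ xs) (y ∷ ys) {p} {p′} (x∈X ∷ xs∈X) (y∈X ∷ ys∈X) np np′ eq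
    with trans (sym (List.++-assoc x (concat xs) p)) (trans eq (List.++-assoc y (concat ys) p′))
  ... | eq′ with x≡y
    where
    x≡y : x ≡ y
    x≡y with ++-compare x y eq′
    ... | inj₁ (t , refl , _) = prefix-free x∈X y∈X (isPrefixOf-++ x t)
    ... | inj₂ (t , refl , _) = sym (prefix-free y∈X x∈X (isPrefixOf-++ y t))
  ...   | refl = cong (x ++_) (factorˡ-unique xs ys xs∈X ys∈X np np′ (List.++-cancelˡ x _ _ eq′))

  factorʳ-unique : ∀ {q q′ x x′} → NoSuffix q → NoSuffix q′ → x ∈ X ⋆ → x′ ∈ X ⋆ → q ++ x ≡ q′ ++ x′ → q ≡ q′ × x ≡ x′
  factorʳ-unique {q} {q′} {x} {x′} ns ns′ x∈ x′∈ eq with ⋆-inv x∈ | ⋆-inv x′∈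
  ... | xs , xs∈X , xs≡ | ys , ys∈X , ys≡ = List.++-cancelʳ x q q′ (trans eq (cong (q′ ++_) (sym x≡x′))) , x≡x′
    where
    inv-eq : concat xs ++ inv q ≡ concat ys ++ inv q′
    inv-eq = trans (cong (_++ inv q) xs≡) (trans (sym (inv-++ q x)) (trans (cong inv eq) (trans (inv-++ q′ x′) (cong (_++ inv q′) (sym ys≡)))))

    x≡x′ : x ≡ x′
    x≡x′ = trans (sym (inv-involutive x)) (trans (cong inv (trans (sym xs≡)
      (trans (factorˡ-unique xs ys xs∈X ys∈X (noPrefix-inv ns) (noPrefix-inv ns′) inv-eq) ys≡))) (inv-involutive x′))

  -- The last components of parses. What precedes a stop factors uniquely from the right, so
  -- counting parses amounts to counting stops.
  Stop : Word A → Word A → Set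
  Stop w p = ∃[ u ] w ≡ u ++ p × NoPrefix p

  stops : Word A → List (Word A)
  stops [] = [ [] ]
  stops (a ∷ w) with prefixIn? (a ∷ w)
  ... | inj₁ _ = stops w
  ... | inj₂ _ = (a ∷ w) ∷ stops w

  ∈-stops⁺ : ∀ w {p} → Stop w p → p ∈ₗ stops w
  ∈-stops⁺ [] {[]} ([] , refl , _) = here refl
  ∈-stops⁺ (a ∷ w) (u , eq , np) with prefixIn? (a ∷ w)
  ∈-stops⁺ (a ∷ w) ([] , refl , np) | inj₁ (x , t , x∈X , eq) = contradiction x∈X (np (subst (x isPrefixOf_) (sym eq) (isPrefixOf-++ x t)))
  ∈-stops⁺ (a ∷ w) (_ ∷ u , refl , np) | inj₁ _ = ∈-stops⁺ w (u , refl , np)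
  ∈-stops⁺ (a ∷ w) ([] , refl , np) | inj₂ _ = here refl
  ∈-stops⁺ (a ∷ w) (_ ∷ u , refl , np) | inj₂ _ = there (∈-stops⁺ w (u , refl , np))

  ∈-stops⁻ : ∀ w {p} → p ∈ₗ stops w → Stop w p
  ∈-stops⁻ [] (here refl) = [] , refl , noPrefix-[]
  ∈-stops⁻ (a ∷ w) p∈ with prefixIn? (a ∷ w)
  ∈-stops⁻ (a ∷ w) p∈ | inj₁ _ with ∈-stops⁻ w p∈
  ... | u , refl , np = a ∷ u , refl , np
  ∈-stops⁻ (a ∷ w) (here refl) | inj₂ np = [] , refl , np
  ∈-stops⁻ (a ∷ w) (there p∈)  | inj₂ _ with ∈-stops⁻ w p∈
  ... | u , refl , np = a ∷ u , refl , np

  stops-unique : ∀ w → Unique (stops w)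
  stops-unique [] = [] ∷ []
  stops-unique (a ∷ w) with prefixIn? (a ∷ w)
  ... | inj₁ _ = stops-unique w
  ... | inj₂ _ = All.tabulate (λ p∈ eq → longer (∈-stops⁻ w p∈) eq) ∷ stops-unique w
    where
    longer : ∀ {p} → Stop w p → a ∷ w ≢ p
    longer (u , eq , _) refl = ℕ.m≢1+n+m (length w) (trans (cong length eq) (trans (List.length-++ u) (ℕ.+-suc (length u) (length w))))

  parseAt : Word A → Word A → Word A × Word A × Word A
  parseAt w p = let q , x , _ = factorʳ (take (length w ∸ length p) w) in q , x , p

  stop⇒parse : ∀ w {p} → Stop w p → IsParse X w (parseAt w p)
  stop⇒parse w {p} (u , refl , np) =
    subst (λ v → IsParse X w (let q , x , _ = factorʳ v in q , x , p)) (sym (take-length-∸ u p)) (parse (factorʳ u))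
    where
    parse : (f : ∃₂ λ q x → u ≡ q ++ x × NoSuffix q × x ∈ X ⋆) → IsParse X (u ++ p) (proj₁ f , proj₁ (proj₂ f) , p)
    parse (q , x , refl , ns , x∈) = record
      { factorization = List.++-assoc q x p ; q-no-suffix = ns ; x∈X⋆ = x∈ ; p-no-prefix = np }

  parse⇒stop : ∀ {w q x p} → IsParse X w (q , x , p) → Stop w p
  parse⇒stop {q = q} {x} {p} t = q ++ x , trans (IsParse.factorization t) (sym (List.++-assoc q x p)) , IsParse.p-no-prefix t

  parse-unique : ∀ {w t t′} → IsParse X w t → IsParse X w t′ → proj₂ (proj₂ t) ≡ proj₂ (proj₂ t′) → t ≡ t′
  parse-unique {w} {q , x , p} {q′ , x′ , p} t t′ refl
    with factorʳ-unique (IsParse.q-no-suffix t) (IsParse.q-no-suffix t′) (IsParse.x∈X⋆ t) (IsParse.x∈X⋆ t′)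
      (List.++-cancelʳ p _ _ (trans (sym (proj₁ (proj₂ (parse⇒stop t)))) (proj₁ (proj₂ (parse⇒stop t′)))))
  ... | refl , refl = refl

  parse-count : ∀ w → HasParseCount X w (length (stops w))
  parse-count w = map (parseAt w) (stops w) , Unique.map⁺ (cong (proj₂ ∘ proj₂)) (stops-unique w) ,
    (λ t → mk⇔
      (λ parse → subst (_∈ₗ map (parseAt w) (stops w)) (parse-unique (stop⇒parse w (parse⇒stop parse)) parse refl)
        (Mem.∈-map⁺ (parseAt w) (∈-stops⁺ w (parse⇒stop parse))))
      (λ t∈ → let p , p∈ , eq = Mem.∈-map⁻ (parseAt w) t∈ in subst (IsParse X w) (sym eq) (stop⇒parse w (∈-stops⁻ w p∈)))) ,
    List.length-map (parseAt w) (stops w)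

  ⋆⇒Generated : ∀ {w} → w ∈ X ⋆ → ⟦ w ⟧ ∈ Generated
  ⋆⇒Generated ([] , [] , refl) = [] , [] , ~-refl
  ⋆⇒Generated (x ∷ xs , x∈X ∷ xs∈X , refl) with ⋆⇒Generated (xs , xs∈X , refl)
  ... | gs , gs∈ , gs~ = ⟦ x ⟧ ∷ gs , (x , x∈X , ~-refl) ∷ gs∈ , ~-trans (·-cong ~-refl gs~) (~-sym (⟦⟧-++ x (concat xs)))

  leftComplete : RightComplete → ∀ u → u ∈ S → ℓ ≤ length u → ∃₂ λ t x → x ∈ X × u ≡ t ++ x
  leftComplete complete u u∈S len with complete (inv u) (S-inv u∈S) (subst (ℓ ≤_) (sym (length-inv u)) len)
  ... | x , t , x∈X , eq = inv t , inv x , X-inv x∈X , trans (sym (inv-involutive u)) (trans (cong inv eq) (inv-++ x t))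

  stop-length : RightComplete → ∀ {w p} → w ∈ S → Stop w p → length p < ℓ
  stop-length complete {p = p} w∈S (u , refl , np) = ℕ.≰⇒> λ ℓ≤ →
    let x , t , x∈X , eq = complete p (suffix-S u w∈S) ℓ≤ in
    np (subst (x isPrefixOf_) (sym eq) (isPrefixOf-++ x t)) x∈X

  module Index (H : Subgroup (Gθ θ)) (generates : Generated ≐ Subgroup.Member H) where
    open Subgroup H

    ⋆⇒Member : ∀ {w} → w ∈ X ⋆ → ⟦ w ⟧ ∈ Member
    ⋆⇒Member = proj₁ generates ∘ ⋆⇒Generated

    Member⇒⋆ : ∀ {w} → w ∈ S → ⟦ w ⟧ ∈ Member → w ∈ X ⋆
    Member⇒⋆ w∈S = S∩Generated⊆⋆ w∈S ∘ proj₂ generates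

    -- The difference of the two stops is `t`. Being in `S` and in the subgroup, it is in `X ⋆`; if
    -- nonempty, it would begin with an element of `X`, and so would the longer stop.
    stop-difference : ∀ {p} t → t ++ p ∈ S → NoPrefix (t ++ p) → ⟦ t ++ p ⟧ · ⟦ p ⟧ ⁻ ∈ Member → t ++ p ≡ p
    stop-difference {p} t tp∈S np m with ⋆⇒prefix (Member⇒⋆ (prefix-S t p tp∈S)
      (resp (~-trans (·-cong (⟦⟧-++ t p) ~-refl) (//-rightDividesʳ ⟦ p ⟧ ⟦ t ⟧)) m))
    ... | inj₁ refl = refl
    ... | inj₂ (x , s , x∈X , refl) =
      contradiction x∈X (np (subst (x isPrefixOf_) (sym (List.++-assoc x s p)) (isPrefixOf-++ x (s ++ p))))

    stop-injective : ∀ {w p p′} → w ∈ S → Stop w p → Stop w p′ → ⟦ p ⟧ · ⟦ p′ ⟧ ⁻ ∈ Member → p ≡ p′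
    stop-injective {p = p} {p′} w∈S (u , refl , np) (u′ , eq , np′) m with ++-compare u u′ eq
    ... | inj₁ (t , _ , refl) = stop-difference t (suffix-S u w∈S) np m
    ... | inj₂ (t , _ , refl) = sym (stop-difference t (suffix-S u′ (subst (_∈ S) eq w∈S)) np′
      (resp (⁻¹-anti-homo-// ⟦ p ⟧ ⟦ p′ ⟧) (⁻¹-closed m)))

    Reached : Word A → Pred (Expr A) 0ℓ
    Reached w g = ∃[ p ] Stop w p × g · ⟦ p ⟧ ⁻ ∈ Member

    module _ (complete : RightComplete) where

      private
        cancel : ∀ g k h → _~_ θ (g · h · (k · h) ⁻) (g · k ⁻)
        cancel g k h = begin
          g · h · (k · h) ⁻      ≈⟨ ·-cong ~-refl (⁻¹-anti-homo-∙ k h) ⟩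
          g · h · (h ⁻ · k ⁻)    ≈⟨ ~-sym (·-assoc _ _ _) ⟩
          g · h · h ⁻ · k ⁻      ≈⟨ ·-cong (//-rightDividesʳ h g) ~-refl ⟩
          g · k ⁻                ∎

        ⟦∷ʳ⟧ : ∀ p b → _~_ θ ⟦ p ++ [ b ] ⟧ (⟦ p ⟧ · gen b)
        ⟦∷ʳ⟧ p b = ~-trans (⟦⟧-++ p [ b ]) (·-cong ~-refl (identityʳ (gen b)))

        cancel-∷ʳ : ∀ g p b → _~_ θ (g · gen b · ⟦ p ++ [ b ] ⟧ ⁻) (g · ⟦ p ⟧ ⁻)
        cancel-∷ʳ g p b = ~-trans (·-cong ~-refl (⁻-cong (⟦∷ʳ⟧ p b))) (cancel g ⟦ p ⟧ (gen b))

        to-base : ∀ {g p b} → g · ⟦ p ⟧ ⁻ ∈ Member → p ++ [ b ] ∈ X → g · gen b · ⟦ [] ⟧ ⁻ ∈ Member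
        to-base {g} {p} {b} m pb∈X = resp (begin
          g · ⟦ p ⟧ ⁻ · ⟦ p ++ [ b ] ⟧      ≈⟨ ·-cong ~-refl (⟦∷ʳ⟧ p b) ⟩
          g · ⟦ p ⟧ ⁻ · (⟦ p ⟧ · gen b)    ≈⟨ ~-sym (·-assoc _ _ _) ⟩
          g · ⟦ p ⟧ ⁻ · ⟦ p ⟧ · gen b      ≈⟨ ·-cong (//-rightDividesˡ ⟦ p ⟧ g) ~-refl ⟩
          g · gen b                         ≈⟨ ~-sym (identityʳ _) ⟩
          g · gen b · one                   ≈⟨ ·-cong ~-refl (~-sym ε⁻¹≈ε) ⟩
          g · gen b · one ⁻                 ∎) (∙-closed m (⋆⇒Member (∈⇒⋆ pb∈X)))

        from-base : ∀ {g p b} → g · gen b · ⟦ [] ⟧ ⁻ ∈ Member → p ++ [ b ] ∈ X → g · ⟦ p ⟧ ⁻ ∈ Member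
        from-base {g} {p} {b} m pb∈X = resp (begin
          g · gen b · one ⁻ · ⟦ p ++ [ b ] ⟧ ⁻   ≈⟨ ·-cong (~-trans (·-cong ~-refl ε⁻¹≈ε) (identityʳ _)) ~-refl ⟩
          g · gen b · ⟦ p ++ [ b ] ⟧ ⁻           ≈⟨ cancel-∷ʳ g p b ⟩
          g · ⟦ p ⟧ ⁻                            ∎) (∙-closed m (⁻¹-closed (⋆⇒Member (∈⇒⋆ pb∈X))))

        ∷ʳ-prefix : ∀ {p : Word A} {b} x t → p ++ [ b ] ≡ x ++ t → t ≡ [] ⊎ x isPrefixOf p
        ∷ʳ-prefix {p} {b} x t eq with initLast t
        ... | []       = inj₁ refl
        ... | t′ ∷ʳ′ c = inj₂ (subst (x isPrefixOf_)
          (sym (List.∷ʳ-injectiveˡ p (x ++ t′) (trans eq (sym (List.++-assoc x t′ [ c ]))))) (isPrefixOf-++ x t′))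

        noPrefix-init : ∀ {p b} → p ++ [ b ] ∈ X → NoPrefix p
        noPrefix-init {p} {b} pb∈X {y} y≤p y∈X with prefix⇒++ y≤p
        ... | t , refl = ℕ.m≢1+m+n (length y) {length t} (trans
          (cong length (prefix-free y∈X pb∈X (subst (y isPrefixOf_) (sym (List.++-assoc y t [ b ])) (isPrefixOf-++ y (t ++ [ b ])))))
          (trans (List.length-++ (y ++ t)) (trans (ℕ.+-comm _ 1) (cong suc (List.length-++ y)))))

        stop-∷ʳ : ∀ {w p b} → Stop w p → NoPrefix (p ++ [ b ]) → Stop (w ++ [ b ]) (p ++ [ b ])
        stop-∷ʳ {p = p} {b} (u , refl , _) np = u , List.++-assoc u p [ b ] , np

        stop-[] : ∀ w → Stop w []
        stop-[] w = w , sym (List.++-identityʳ w) , noPrefix-[]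

        stop-∷ : ∀ {w p} a → Stop w p → Stop (a ∷ w) p
        stop-∷ a (u , refl , np) = a ∷ u , refl , np

        -- By completeness the stop is not all of `a ∷ w`. Followed by `b` it is again a stop,
        -- unless it becomes an element of `X`; then the coset is that of the empty stop.
        slide⇒ : ∀ a w b → length w ≡ ℓ → (a , b) ∈ B S w → ∀ g → Reached (a ∷ w) g → Reached (w ++ [ b ]) (g · gen b)
        slide⇒ a w b len awb∈S g (p , stop@([] , refl , np) , m) =
          contradiction (stop-length complete (prefix-S (a ∷ w) [ b ] awb∈S) stop) (ℕ.<-asym (s≤s (ℕ.≤-reflexive (sym len))) )
        slide⇒ a w b len awb∈S g (p , (_ ∷ u , refl , np) , m) with prefixIn? (p ++ [ b ])
        ... | inj₂ np′ = p ++ [ b ] , stop-∷ʳ (u , refl , np) np′ , resp (~-sym (cancel-∷ʳ g p b)) m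
        ... | inj₁ (x , t , x∈X , eq) with ∷ʳ-prefix {p} {b} x t eq
        ...   | inj₂ x≤p  = contradiction x∈X (np x≤p)
        ...   | inj₁ refl = [] , stop-[] _ , to-base m (subst (_∈ X) (sym (trans eq (List.++-identityʳ x))) x∈X)

        -- The empty stop is traced back through a suffix `p ++ [ b ]` in `X`, found by left
        -- completeness; as `X` is prefix-free, `p` is a stop.
        slide⇐ : ∀ a w b → length w ≡ ℓ → (a , b) ∈ B S w → ∀ g → Reached (w ++ [ b ]) (g · gen b) → Reached (a ∷ w) g
        slide⇐ a w b len awb∈S g (p′ , (u , eq , np) , m) with initLast p′
        ... | p ∷ʳ′ c with List.∷ʳ-injective w (u ++ p) (trans eq (sym (List.++-assoc u p [ c ])))
        ...   | refl , refl = p , stop-∷ a (u , refl , λ {x} x≤p → np (subst (x isPrefixOf_)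
          (trans (sym (List.++-assoc x _ [ b ])) (cong (_++ [ b ]) (sym (proj₂ (prefix⇒++ x≤p))))) (isPrefixOf-++ x _))) ,
          resp (cancel-∷ʳ g p b) m
        slide⇐ a w b len awb∈S g (.[] , _ , m) | []
          with leftComplete complete (w ++ [ b ]) (suffix-S [ a ] awb∈S)
            (subst (_≤ length (w ++ [ b ])) len (List.length-++-≤ˡ w))
        ... | t , x , x∈X , eq with initLast x
        ...   | [] = contradiction x∈X nonempty
        ...   | p ∷ʳ′ c with List.∷ʳ-injective w (t ++ p) (trans eq (sym (List.++-assoc t p [ c ])))
        ...     | refl , refl = p , stop-∷ a (t , refl , noPrefix-init x∈X) , from-base m x∈X

        -- Inversion exchanges the outer parts of a parse; the middle part `x` lies in the subgroup,
        -- so the cosets correspond.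
        turn : ∀ w g → Reached w g → Reached (inv w) (g · ⟦ w ⟧ ⁻)
        turn w g (p , (u , refl , np) , m) with factorʳ u
        ... | q , x , refl , ns , x∈X⋆ = inv q ,
          (inv p ++ inv x , trans (inv-++ (q ++ x) p) (trans (cong (inv p ++_) (inv-++ q x)) (sym (List.++-assoc (inv p) (inv x) (inv q)))) , noPrefix-inv ns) ,
          resp (~-sym (begin
            g · ⟦ (q ++ x) ++ p ⟧ ⁻ · ⟦ inv q ⟧ ⁻
              ≈⟨ ·-cong (·-cong ~-refl (⁻-cong (~-trans (⟦⟧-++ (q ++ x) p) (·-cong (⟦⟧-++ q x) ~-refl)))) (~-trans (⁻-cong (⟦⟧-inv q)) (⁻¹-involutive ⟦ q ⟧)) ⟩
            g · (⟦ q ⟧ · ⟦ x ⟧ · ⟦ p ⟧) ⁻ · ⟦ q ⟧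
              ≈⟨ ·-cong (·-cong ~-refl (~-trans (⁻¹-anti-homo-∙ (⟦ q ⟧ · ⟦ x ⟧) ⟦ p ⟧) (·-cong ~-refl (⁻¹-anti-homo-∙ ⟦ q ⟧ ⟦ x ⟧)))) ~-refl ⟩
            g · (⟦ p ⟧ ⁻ · (⟦ x ⟧ ⁻ · ⟦ q ⟧ ⁻)) · ⟦ q ⟧
              ≈⟨ ·-cong (~-trans (~-sym (·-assoc _ _ _)) (~-sym (·-assoc _ _ _))) ~-refl ⟩
            g · ⟦ p ⟧ ⁻ · ⟦ x ⟧ ⁻ · ⟦ q ⟧ ⁻ · ⟦ q ⟧
              ≈⟨ //-rightDividesˡ ⟦ q ⟧ _ ⟩
            g · ⟦ p ⟧ ⁻ · ⟦ x ⟧ ⁻ ∎))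
            (∙-closed m (⁻¹-closed (⋆⇒Member x∈X⋆)))

      equivariant : Equivariant ℓ Reached
      equivariant = record
        { resp  = λ { w g~h (p , stop , m) → p , stop , resp (·-cong g~h ~-refl) m }
        ; slide = λ a w b len e g → mk⇔ (slide⇒ a w b len e g) (slide⇐ a w b len e g)
        ; turn  = λ w _ _ → turn w
        }

      module _ {w} (w∈S : w ∈ S) (len : length w ≡ suc ℓ) where

        -- The empty stop puts `one` into the set, which is therefore everything.
        reached : ∀ h → Reached w h
        reached h = all-or-nothing ℓ equivariant w w∈S len one h ([] , stop-[] w , resp (~-sym (inverseʳ one)) ε-closed)

        private
          module C = Setoid (Cosets (Gθ θ) H)

          representative : Fin (length (stops w)) → Expr A
          representative i = ⟦ lookup (stops w) i ⟧

          coset : Expr A → Fin (length (stops w))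
          coset h = Any.index (∈-stops⁺ w (proj₁ (proj₂ (reached h))))

          coset-spec : ∀ h → h C.≈ representative (coset h)
          coset-spec h = subst (λ p → h · ⟦ p ⟧ ⁻ ∈ Member) (Any.lookup-index (∈-stops⁺ w (proj₁ (proj₂ (reached h))))) (proj₂ (proj₂ (reached h)))

          coset-unique : ∀ h i → h C.≈ representative i → coset h ≡ i
          coset-unique h i h≈i = lookup-injective (stops-unique w)
            (stop-injective w∈S (∈-stops⁻ w (Mem.∈-lookup (coset h))) (∈-stops⁻ w (Mem.∈-lookup i))
              (C.trans {representative (coset h)} {h} {representative i} (C.sym {h} {representative (coset h)} (coset-spec h)) h≈i))

        index-stops : HasIndex (Gθ θ) H (length (stops w))
        index-stops = record
          { to        = coset
          ; from      = representative
          ; to-cong   = λ {g} {h} g≈h → coset-unique g (coset h) (C.trans {g} {h} {representative (coset h)} g≈h (coset-spec h))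
          ; from-cong = λ { {i} refl → C.refl {representative i} }
          ; inverse   = (λ {i} {h} → coset-unique h i) , λ { {h} refl → C.sym {h} {representative (coset h)} (coset-spec h) }
          }

    parse-count-≤ : ∀ {e w n} → HasIndex (Gθ θ) H e → w ∈ S → HasParseCount X w n → n ≤ e
    parse-count-≤ {w = w} I w∈S (ts , unique , parses , refl) =
      Fin.injective⇒≤ {f = λ i → Inverse.to I ⟦ proj₂ (proj₂ (lookup ts i)) ⟧} λ {i} {j} eq →
        lookup-injective unique (parse-unique (parse i) (parse j)
          (stop-injective w∈S (parse⇒stop (parse i)) (parse⇒stop (parse j)) (coset-injective (Gθ θ) H I eq)))
      where
      parse : ∀ i → IsParse X w (lookup ts i)
      parse i = Equivalence.from (parses (lookup ts i)) (Mem.∈-lookup i)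

  -- Maximality, finite index and completeness

  extendRight : ∀ n w → w ∈ S → ∃[ v ] w ++ v ∈ S × length v ≡ n
  extendRight zero    w w∈S = [] , subst (_∈ S) (sym (List.++-identityʳ w)) w∈S , refl
  extendRight (suc n) w w∈S with extendable w w∈S
  ... | (a , b) , e with extendRight n (w ++ [ b ]) (suffix-S [ a ] e)
  ...   | v , wbv∈S , len = b ∷ v , subst (_∈ S) (List.++-assoc w [ b ] v) wbv∈S , cong suc len

  module _ (recurrent : Recurrent S) where
    open Recurrent recurrent using (recur)

    -- Recurrence joins `u` to `inv u`. The resulting `y` and its inverse both begin with `u`, so
    -- `y` has no prefix in `X` and, by symmetry of `X`, no suffix either; it is too long to be
    -- inside an element of `X`.
    maximal⇒complete : IsMaximalBifixCode S X → RightComplete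
    maximal⇒complete maximal u u∈S len with prefixIn? u
    ... | inj₁ found = found
    ... | inj₂ np with recur u (inv u) u∈S (S-inv u∈S)
    ...   | v , _ , y∈S = ⊥-elim (IsMaximalBifixCode.maximal maximal Y Y-bifix Y⊆S (inj₁ , λ Y⊆X → ¬long (Y⊆X (inj₂ refl)) (List.length-++-≤ˡ u)))
      where
      y : Word A
      y = u ++ v ++ inv u

      Y : Language A
      Y w = w ∈ X ⊎ w ≡ y

      ¬long : ∀ {x} → x ∈ X → ¬ length u ≤ length x
      ¬long x∈X u≤x = ℕ.<⇒≱ (length<ℓ x∈X) (ℕ.≤-trans len u≤x)

      ¬prefix : ∀ {x t} → x ∈ X → ¬ x isPrefixOf (u ++ t)
      ¬prefix {x} {t} x∈X x≤ with prefix⇒++ x≤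
      ... | s , eq with ++-compare u x eq
      ...   | inj₁ (r , refl , _) = ¬long x∈X (List.length-++-≤ˡ u)
      ...   | inj₂ (r , refl , _) = np (isPrefixOf-++ x r) x∈X

      ¬suffix : ∀ {x} → x ∈ X → ¬ x isSuffixOf y
      ¬suffix {x} x∈X x≤ with suffix⇒++ x≤
      ... | s , eq = ¬prefix (X-inv x∈X) (subst (inv x isPrefixOf_) inv-y (isPrefixOf-++ (inv x) (inv s)))
        where
        inv-y : inv x ++ inv s ≡ u ++ inv (u ++ v)
        inv-y = trans (sym (inv-++ s x)) (trans (cong inv (trans (sym eq) (sym (List.++-assoc u v (inv u)))))
          (trans (inv-++ (u ++ v) (inv u)) (cong (_++ inv (u ++ v)) (inv-involutive u))))

      Y⊆S : Y ⊆ S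
      Y⊆S (inj₁ x∈X)  = X⊆S x∈X
      Y⊆S (inj₂ refl) = y∈S

      Y-bifix : BifixCode Y
      Y-bifix = record
        { nonempty = λ { (inj₁ x∈X) → nonempty x∈X ; (inj₂ []≡y) → contradiction (subst (ℓ ≤_) (cong length (List.++-conicalˡ u _ (sym []≡y))) len) λ () }
        ; prefix-free = λ
          { (inj₁ x∈X) (inj₁ x′∈X) x≤ → prefix-free x∈X x′∈X x≤
          ; (inj₁ x∈X) (inj₂ refl) x≤ → contradiction x≤ (¬prefix x∈X)
          ; (inj₂ refl) (inj₁ x∈X) y≤ → contradiction (ℕ.≤-trans (List.length-++-≤ˡ u) (PrefixProperties.length-mono y≤)) (¬long x∈X)
          ; (inj₂ refl) (inj₂ refl) _ → refl
          }
        ; suffix-free = λ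
          { (inj₁ x∈X) (inj₁ x′∈X) x≤ → suffix-free x∈X x′∈X x≤
          ; (inj₁ x∈X) (inj₂ refl) x≤ → contradiction x≤ (¬suffix x∈X)
          ; (inj₂ refl) (inj₁ x∈X) y≤ → contradiction (ℕ.≤-trans (List.length-++-≤ˡ u) (SuffixProperties.length-mono y≤)) (¬long x∈X)
          ; (inj₂ refl) (inj₂ refl) _ → refl
          }
        }

    -- A long word u without prefix in X would be read infinitely often in
    -- S without returning to the subgroup, whose cosets are finitely many.
    finiteIndex⇒complete : ∀ {d} (H : Subgroup (Gθ θ)) → Generated ≐ Subgroup.Member H → HasIndex (Gθ θ) H d → RightComplete
    finiteIndex⇒complete {d} H generates I u u∈S len with prefixIn? u
    ... | inj₁ found = found
    ... | inj₂ np = ⊥-elim (repeated (Fin.pigeonhole (ℕ.n<1+n d) λ i → Inverse.to I ⟦ proj₁ (W (toℕ i)) ⟧))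
      where
      open Subgroup H
      open Index H generates

      W : ℕ → ∃[ w ] w ∈ S
      W zero    = u , u∈S
      W (suc k) = let v , _ , uvw∈S = recur u (proj₁ (W k)) u∈S (proj₂ (W k)) in u ++ v ++ proj₁ (W k) , uvw∈S

      W-suffix : ∀ {i j} → i ≤ j → ∃[ r ] proj₁ (W j) ≡ r ++ proj₁ (W i)
      W-suffix {j = zero} z≤n = [] , refl
      W-suffix {i} {suc j} i≤j with ℕ.m≤n⇒m<n∨m≡n i≤j
      ... | inj₂ refl = [] , refl
      ... | inj₁ (s≤s i≤j′) with W-suffix i≤j′
      ...   | r , eq = u ++ v ++ r , trans (cong (λ z → u ++ v ++ z) eq)
        (trans (cong (u ++_) (sym (List.++-assoc v r _))) (sym (List.++-assoc u (v ++ r) _)))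
        where v = proj₁ (recur u (proj₁ (W j)) u∈S (proj₂ (W j)))

      W-between : ∀ {i j} → i < j → ∃[ r ] proj₁ (W j) ≡ (u ++ r) ++ proj₁ (W i)
      W-between {j = suc j} (s≤s i≤j) with W-suffix i≤j
      ... | r , eq = v ++ r , trans (cong (λ z → u ++ v ++ z) eq)
        (trans (cong (u ++_) (sym (List.++-assoc v r _))) (sym (List.++-assoc u (v ++ r) _)))
        where v = proj₁ (recur u (proj₁ (W j)) u∈S (proj₂ (W j)))

      repeated : (∃₂ λ (i j : Fin (suc d)) → toℕ i < toℕ j × Inverse.to I ⟦ proj₁ (W (toℕ i)) ⟧ ≡ Inverse.to I ⟦ proj₁ (W (toℕ j)) ⟧) → ⊥
      repeated (i , j , i<j , same) with W-between i<j
      ... | r , eq with ⋆⇒prefix (Member⇒⋆ (prefix-S (u ++ r) _ (subst (_∈ S) eq (proj₂ (W (toℕ j)))))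
        (resp (~-trans (·-cong (~-trans (subst (λ z → _~_ θ ⟦ proj₁ (W (toℕ j)) ⟧ ⟦ z ⟧) eq ~-refl) (⟦⟧-++ (u ++ r) _)) ~-refl)
          (//-rightDividesʳ ⟦ proj₁ (W (toℕ i)) ⟧ ⟦ u ++ r ⟧)) (coset-injective (Gθ θ) H I (sym same))))
      ... | inj₁ ur≡[] = contradiction (subst (ℓ ≤_) (cong length (List.++-conicalˡ u r ur≡[])) len) λ ()
      ... | inj₂ (x , t , x∈X , ur≡) with ++-compare u x ur≡
      ...   | inj₁ (s , refl , _) = ℕ.<⇒≱ (length<ℓ x∈X) (ℕ.≤-trans len (List.length-++-≤ˡ u))
      ...   | inj₂ (s , refl , _) = np (isPrefixOf-++ x s) x∈X

  generated-⁻¹ : ∀ {g} → g ∈ Generated → g ⁻ ∈ Generated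
  generated-⁻¹ (gs , gs∈ , gs~) with factorWords gs∈
  ... | xs , xs∈X , xs≃ with ⋆⇒Generated (⋆-inv (xs , xs∈X , refl))
  ...   | hs , hs∈ , hs~ = hs , hs∈ ,
    ~-trans hs~ (~-trans (⟦⟧-inv (concat xs)) (⁻-cong (~-trans (⟦concat⟧ xs≃) gs~)))

  product-++ : ∀ gs hs → _~_ θ (product (Gθ θ) (gs ++ hs)) (product (Gθ θ) gs · product (Gθ θ) hs)
  product-++ []       hs = ~-sym (identityˡ _)
  product-++ (g ∷ gs) hs = ~-trans (·-cong ~-refl (product-++ gs hs)) (~-sym (·-assoc _ _ _))

  generatedSubgroup : Subgroup (Gθ θ)
  generatedSubgroup = record
    { Member    = Generated
    ; resp      = λ { p (gs , gs∈ , gs~) → gs , gs∈ , ~-trans gs~ p }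
    ; ε-closed  = [] , [] , ~-refl
    ; ∙-closed  = λ { (gs , gs∈ , gs~) (hs , hs∈ , hs~) → gs ++ hs , All.++⁺ gs∈ hs∈ , ~-trans (product-++ gs hs) (·-cong gs~ hs~) }
    ; ⁻¹-closed = generated-⁻¹
    }

  generatedSubgroup-basis : IsMonoidalBasis (Gθ θ) (⟪_⟫ θ X) generatedSubgroup
  generatedSubgroup-basis = record
    { subset    = λ {g} g∈ → [ g ] , g∈ ∷ [] , identityʳ g
    ; symmetric = λ { (w , w∈X , w~) → inv w , X-inv w∈X , ~-trans (⟦⟧-inv w) (⁻-cong w~) }
    ; generates = id , id
    ; free      = free
    }

  -- A word of a larger code, extended to the right in `S`, begins with an element of `X`. The two
  -- are comparable as prefixes and both lie in the larger code, hence agree.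
  complete⇒maximal : RightComplete → IsMaximalBifixCode S X
  complete⇒maximal complete = record
    { bifix = bifix ; subset = X⊆S ; maximal = λ Y Y-bifix Y⊆S (X⊆Y , Y⊈X) → Y⊈X (Y⊆X Y-bifix Y⊆S X⊆Y) }
    where
    Y⊆X : ∀ {Y} → BifixCode Y → Y ⊆ S → X ⊆ Y → Y ⊆ X
    Y⊆X Y-bifix Y⊆S X⊆Y {y} y∈Y with extendRight ℓ y (Y⊆S y∈Y)
    ... | v , yv∈S , len with complete (y ++ v) yv∈S (subst (_≤ length (y ++ v)) len (List.length-++-≤ʳ v {y}))
    ...   | x , t , x∈X , eq with ++-compare y x eq
    ...     | inj₁ (s , refl , _) = subst (_∈ X) (sym (BifixCode.prefix-free Y-bifix y∈Y (X⊆Y x∈X) (isPrefixOf-++ y s))) x∈X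
    ...     | inj₂ (s , refl , _) = subst (_∈ X) (BifixCode.prefix-free Y-bifix (X⊆Y x∈X) y∈Y (isPrefixOf-++ x s)) x∈X

  -- The two implications

  module _ (recurrent : Recurrent S) where

    private
      -- One letter more than `ℓ`, since sliding moves along middle words of length `ℓ`.
      long : ∃[ w ] w ∈ S × length w ≡ suc ℓ
      long = extendRight (suc ℓ) [] []∈S

      w : Word A
      w = proj₁ long

    maximal⇒basis : ∀ {d} → IsMaximalBifixCode S X × HasDegree S X d →
      Σ[ H ∈ Subgroup (Gθ θ) ] HasIndex (Gθ θ) H d × IsMonoidalBasis (Gθ θ) (⟪_⟫ θ X) H
    maximal⇒basis {d} (maximal , degree) =
      generatedSubgroup , subst (HasIndex (Gθ θ) generatedSubgroup) d≡ index , generatedSubgroup-basis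
      where
      open Index generatedSubgroup (id , id)

      index : HasIndex (Gθ θ) generatedSubgroup (length (stops w))
      index = index-stops (maximal⇒complete recurrent maximal) (proj₁ (proj₂ long)) (proj₂ (proj₂ long))

      -- The long word has at most `d` parses; conversely, a word attaining the degree has at most
      -- as many parses as there are cosets.
      d≡ : length (stops w) ≡ d
      d≡ with HasDegree.attained degree
      ... | _ , v∈S , count = ℕ.≤-antisym
        (HasDegree.bound degree w _ (proj₁ (proj₂ long)) (parse-count w)) (parse-count-≤ index v∈S count)

    basis⇒maximal : ∀ {d} → (Σ[ H ∈ Subgroup (Gθ θ) ] HasIndex (Gθ θ) H d × IsMonoidalBasis (Gθ θ) (⟪_⟫ θ X) H) →
      IsMaximalBifixCode S X × HasDegree S X d
    basis⇒maximal {d} (H , I , basis) = complete⇒maximal complete , record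
      { attained = w , proj₁ (proj₂ long) , subst (HasParseCount X w) (ℕ.≤-antisym (index-≤ (Gθ θ) H index I) (index-≤ (Gθ θ) H I index)) (parse-count w)
      ; bound    = λ v n v∈S count → parse-count-≤ I v∈S count
      }
      where
      open Index H (IsMonoidalBasis.generates basis)

      complete : RightComplete
      complete = finiteIndex⇒complete recurrent H (IsMonoidalBasis.generates basis) I

      index : HasIndex (Gθ θ) H (length (stops w))
      index = index-stops complete (proj₁ (proj₂ long)) (proj₂ (proj₂ long))

theorem8p1 : ∀ {A : Set} {n : ℕ} → A ↔ Fin n →
    (θ : A → A) → (∀ a → θ (θ a) ≡ a) →
    (S : Language A) → Recurrent S → IsSpecular θ S →
    (X : Language A) → X ⊆ S → IsFinite X → IsSymmetric (Gθ θ) (⟪_⟫ θ X) → BifixCode X →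
    (d : ℕ) → 1 ≤ d →
    (IsMaximalBifixCode S X × HasDegree S X d)
    ⇔
    (Σ[ H ∈ Subgroup (Gθ θ) ] HasIndex (Gθ θ) H d × IsMonoidalBasis (Gθ θ) (⟪_⟫ θ X) H)
theorem8p1 A↔Fin θ θ-involutive S recurrent specular X X⊆S finite symmetric bifix d _ =
  mk⇔ (maximal⇒basis recurrent) (basis⇒maximal recurrent)
  where
  _≟_ : DecidableEquality _
  _≟_ = Fin.inj⇒≟ (↔⇒↣ A↔Fin)

  open Degree _≟_ θ θ-involutive S specular X X⊆S finite bifix
    (Presented.symmetric⇒inv-closed _≟_ θ θ-involutive
      (IsLaminary.reduced (IsSpecular.laminary specular) ∘ X⊆S) symmetric)
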